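{- The containment problem for EPTC — given EPTC formulas $\varphi,\psi$, decide whether $\varphi\to\psi$ is valid (true in every structure under every assignment) — is $\Pi^0_1$-complete. This holds even if all transitive closure operators are at most dyadic (of length $k\le2$).
   Context: Fix a relational signature $\sigma$. EPTC formulas: $\varphi ::= R\bar x\mid x=x'\mid\varphi\lor\varphi\mid\varphi\land\varphi\mid\exists x\,\varphi\mid[\varphi]^*_{\bar v\bar w}\bar x\bar y$ with $\bar x,\bar y,\bar v,\bar w$ of equal length $k\ge1$ and $\bar v\bar w$ pairwise distinct; the transitive closure formula is $k$-adic. Semantics: first-order, with $\mathfrak{A},I\models[\chi]^*_{\bar v\bar w}\bar x\bar y$ iff there are $n\ge0$ and $\bar a_0=I(\bar x),\dots,\bar a_n=I(\bar y)$ with $\mathfrak{A},I[\bar a_{i-1}\bar a_i/\bar v\bar w]\models\chi$ for $1\le i\le n$. Structures have nonempty countable universes. -}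

module Defs where

open import Data.Nat using (ℕ; zero; suc; _≤_; _<ᵇ_; _≡ᵇ_)
open import Data.Bool using (Bool; true; false; if_then_else_)
open import Data.Fin using (Fin; zero; suc)
open import Data.Vec using (Vec; []; _∷_; _++_; toList; map)
open import Data.List using (List; length; lookup)
open import Data.List.Relation.Unary.Unique.Propositional using (Unique)
open import Data.Product using (Σ; ∃; _×_; _,_)
open import Data.Sum using (_⊎_)
open import Data.Unit using (⊤)
open import Relation.Binary.PropositionalEquality using (_≡_)
open import Relation.Binary.Construct.Closure.ReflexiveTransitive using (Star)
open import Function using (Surjective)

-- Relational signature: a relation symbol is a pair (name , arity) of
-- natural numbers, i.e. countably many symbols of every arity (the
-- formulas of the input may use any finitely many of them).

record Sym : Set where
  constructor sym
  field
    name  : ℕ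
    arity : ℕ
open Sym public

Var : Set
Var = ℕ

-- The transitive closure operator [χ]*_{v̄ w̄} x̄ ȳ has tuples of length
-- suc k (so k ≥ 1 as in the paper); v̄ w̄ must be pairwise distinct.
data Formula : Set where
  rel  : (R : Sym) → Vec Var (arity R) → Formula
  eq   : Var → Var → Formula
  _∨'_ : Formula → Formula → Formula
  _∧'_ : Formula → Formula → Formula
  ex   : Var → Formula → Formula
  tc   : (k : ℕ) (χ : Formula) (v w x y : Vec Var (suc k)) →
         Unique (toList (v ++ w)) → Formula

AtMostDyadic : Formula → Set
AtMostDyadic (rel R xs) = ⊤
AtMostDyadic (eq x y) = ⊤
AtMostDyadic (φ ∨' ψ) = AtMostDyadic φ × AtMostDyadic ψ
AtMostDyadic (φ ∧' ψ) = AtMostDyadic φ × AtMostDyadic ψ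
AtMostDyadic (ex x φ) = AtMostDyadic φ
AtMostDyadic (tc k χ v w x y _) = (suc k ≤ 2) × AtMostDyadic χ

-- Semantics.
-- Structures have nonempty countable universes: witnessed by a
-- surjection ℕ → Carrier.

record Structure : Set₁ where
  field
    Carrier   : Set
    enum      : ℕ → Carrier
    enum-surj : Surjective _≡_ _≡_ enum
    interp    : (R : Sym) → Vec Carrier (arity R) → Set
open Structure public

Assignment : Structure → Set
Assignment 𝔄 = Var → Carrier 𝔄

update : {A : Set} → (Var → A) → Var → A → (Var → A)
update I x a y = if y ≡ᵇ x then a else I y

-- I[ā/x̄] (sequential; order is irrelevant for pairwise distinct x̄)
updates : {A : Set} {n : ℕ} → (Var → A) → Vec Var n → Vec A n → (Var → A)
updates I []       []       = I
updates I (x ∷ xs) (a ∷ as) = updates (update I x a) xs as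

Sat : (𝔄 : Structure) → Assignment 𝔄 → Formula → Set
Sat 𝔄 I (rel R xs) = interp 𝔄 R (map I xs)
Sat 𝔄 I (eq x y) = I x ≡ I y
Sat 𝔄 I (φ ∨' ψ) = Sat 𝔄 I φ ⊎ Sat 𝔄 I ψ
Sat 𝔄 I (φ ∧' ψ) = Sat 𝔄 I φ × Sat 𝔄 I ψ
Sat 𝔄 I (ex x φ) = Σ (Carrier 𝔄) λ a → Sat 𝔄 (update I x a) φ
Sat 𝔄 I (tc k χ v w x y _) =
  Star (λ ā b̄ → Sat 𝔄 (updates I (v ++ w) (ā ++ b̄)) χ) (map I x) (map I y)

ValidImp : Formula → Formula → Set₁
ValidImp φ ψ = (𝔄 : Structure) (I : Assignment 𝔄) → Sat 𝔄 I φ → Sat 𝔄 I ψ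

-- Two-counter (Minsky) machines, whose halting problem (from the
-- all-zero configuration) is Σ⁰₁-complete; its complement is the
-- reference Π⁰₁-complete problem.

data Instr : Set where
  inc : (r : Fin 2) (j : ℕ) → Instr          -- c_r := c_r + 1; goto j
  dec : (r : Fin 2) (j k : ℕ) → Instr        -- if c_r = 0 goto k
                                              -- else c_r := c_r - 1; goto j

Program : Set
Program = List Instr

record Config : Set where
  constructor cfg
  field
    pc : ℕ
    c₀ : ℕ
    c₁ : ℕ

initial : Config
initial = cfg 0 0 0

Halted : Program → Config → Set
Halted P (cfg p _ _) = length P ≤ p

private
  incr : Fin 2 → ℕ → ℕ → ℕ → Config
  incr zero    j a b = cfg j (suc a) b
  incr (suc _) j a b = cfg j a (suc b)

  decr : Fin 2 → ℕ → ℕ → ℕ → ℕ → Config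
  decr zero    j k zero    b = cfg k zero b
  decr zero    j k (suc a) b = cfg j a b
  decr (suc _) j k a zero    = cfg k a zero
  decr (suc _) j k a (suc b) = cfg j a b

  exec : Instr → ℕ → ℕ → Config
  exec (inc r j)   a b = incr r j a b
  exec (dec r j k) a b = decr r j k a b

-- one step; halted configurations are fixed points
step : Program → Config → Config
step P c@(cfg p a b) with p <ᵇ length P
... | false = c
... | true  = helper P p
  where
    helper : Program → ℕ → Config
    helper Data.List.[] _ = c
    helper (i Data.List.∷ _)  zero    = exec i a b
    helper (_ Data.List.∷ is) (suc q) = helper is q

run : Program → ℕ → Config
run P zero    = initial
run P (suc n) = step P (run P n)

Halts : Program → Set
Halts P = ∃ λ n → Halted P (run P n)

{-# OPTIONS --safe #-}
-- Membership: EPTC formulas are preserved under homomorphisms, and every model of φ receives a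
-- homomorphism from the canonical model of some unfolding of φ, the finite structure obtained by
-- fixing a disjunct at each ∨ and a number of steps at each transitive closure. So φ → ψ is valid
-- iff ψ holds in the canonical model of every unfolding; each such check is decidable, and
-- enumerating the unfoldings by size exhibits validity as a Π⁰₁ property.
--
-- Hardness: for a two-counter machine P, φ asserts a chain of time points from the initial
-- configuration to one labelled as halted, each time point carrying a program label and, for each
-- counter, a Next-chain ending in Zero. ψ asserts that some step of the chain violates the program,
-- a wrong label or a wrong counter (two counters are compared by walking their chains in lockstep, a
-- dyadic transitive closure), or that some time point is labelled both halted and running. If P never
-- halts, following the chain in any model of φ meets a violation or reaches the halted label while the
-- run is still going, so ψ holds; if P halts after N steps, the run itself is a model of φ and not of ψ.

module Submission where

open import Defs renaming (sym to symbol; _∧'_ to infixr 6 _∧'_; _∨'_ to infixr 5 _∨'_)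
open import Data.Bool using (Bool; true; false; T; if_then_else_)
open import Data.Bool.Properties using (T-≡; if-eta)
open import Data.Empty using (⊥)
open import Data.Fin using (Fin; toℕ) renaming (zero to fzero; suc to fsuc)
import Data.Fin.Properties as Fin
open import Data.Fin.Properties using (toℕ-fromℕ<; toℕ<n; toℕ-injective)
open import Data.List using (List; []; _∷_; length; filter; upTo; cartesianProductWith; cartesianProduct; allFin)
import Data.List as List
open import Data.List.Properties using (length-++)
open import Data.List.Membership.Propositional using (_∈_)
open import Data.List.Membership.Propositional.Properties
  using (∈-map⁺; ∈-map⁻; ∈-++⁺ˡ; ∈-++⁺ʳ; ∈-++⁻; ∈-∃++; ∈-filter⁺; ∈-filter⁻; ∈-upTo⁺; ∈-upTo⁻;
         ∈-cartesianProductWith⁺; ∈-cartesianProduct⁺; ∈-allFin)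
open import Data.List.Relation.Binary.Subset.Propositional using (_⊆_)
open import Data.List.Relation.Binary.Subset.Propositional.Properties using (xs⊆xs++ys; xs⊆ys++xs)
open import Data.List.Relation.Unary.All using (All; []; _∷_; all?)
import Data.List.Relation.Unary.All as All
open import Data.List.Relation.Unary.All.Properties using (++⁺; ¬Any⇒All¬; All¬⇒¬Any)
open import Data.List.Relation.Unary.AllPairs using ([]; _∷_)
open import Data.List.Relation.Unary.Any as Any using (here; there; any?; satisfied)
open import Data.List.Relation.Unary.Unique.Propositional using (Unique)
open import Data.Nat using (ℕ; zero; suc; _+_; _≤_; _<_; _≡ᵇ_; _<ᵇ_; _⊔_; _⊓_; _≟_; _<?_; z≤n; s≤s)
open import Data.Nat.DivMod using (_mod_; m<n⇒m%n≡m)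
import Data.Nat.Properties as ℕ
open import Data.Nat.Properties
  using (≤-refl; ≤-trans; ≤-reflexive; ≤-pred; <-≤-trans; <⇒≤; <⇒≢; ≮⇒≥; n<1+n; n≤1+n; m<n⇒m<1+n; m≤n⇒m≤1+n;
         m<1+n⇒m<n∨m≡n; m≤m+n; +-suc; +-identityʳ; suc-injective; m≤m⊔n; m≤n⊔m; m⊓n≤n; m≤n⇒m⊓n≡m; m≥n⇒m⊓n≡n;
         <-irrefl; ≡ᵇ⇒≡; ≡⇒≡ᵇ; <ᵇ⇒<; <⇒<ᵇ)
open import Data.Product using (Σ; _×_; _,_; proj₁; proj₂)
import Data.Product.Properties as Product
open import Data.Sum using (_⊎_; inj₁; inj₂)
open import Data.Unit using (⊤; tt)
open import Data.Vec using (Vec; []; _∷_; _++_; map; zip; toList)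
import Data.Vec.Properties as Vec
open import Data.Vec.Properties using (map-++; map-∘; map-id; ∷-injective)
open import Data.Vec.Relation.Unary.All using ([]; _∷_) renaming (All to VecAll)
import Data.Vec.Relation.Unary.All as VecAll
open import Data.Vec.Relation.Unary.All.Properties using () renaming (++⁺ to VecAll-++⁺)
open import Function using (_∘_; id)
open import Function.Bundles using (_⇔_; mk⇔; Equivalence)
open import Relation.Nullary using (Dec; yes; no; ¬_; ¬?; contradiction)
open import Relation.Nullary.Decidable using (_×-dec_; _⊎-dec_; map′; isYes; toWitness; fromWitness)
open import Relation.Binary.Definitions using (DecidableEquality)
open import Relation.Binary.PropositionalEquality using (_≡_; _≢_; refl; sym; trans; subst; subst₂; cong; cong₂; module ≡-Reasoning)
open import Relation.Binary.Construct.Closure.ReflexiveTransitive using (Star; ε; _◅_; _◅◅_; gmap)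

-- Assignments and preservation under homomorphisms

module _ {A : Set} (I : Var → A) (x : Var) (a : A) where

  update-≡ : update I x a x ≡ a
  update-≡ with x ≡ᵇ x | ≡⇒≡ᵇ x x refl
  ... | true | _ = refl

  update-≢ : ∀ {y} → y ≢ x → update I x a y ≡ I y
  update-≢ {y} y≢x with y ≡ᵇ x | ≡ᵇ⇒≡ y x
  ... | false | _   = refl
  ... | true  | y≡x = contradiction (y≡x _) y≢x

AgreeBelow : {A : Set} → ℕ → (Var → A) → (Var → A) → Set
AgreeBelow V I J = ∀ y → y < V → I y ≡ J y

AgreeBelow-trans : ∀ {A : Set} {m n} {g₃ g₂ g₁ : Var → A} →
                   m ≤ n → AgreeBelow n g₃ g₂ → AgreeBelow m g₂ g₁ → AgreeBelow m g₃ g₁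
AgreeBelow-trans m≤n ag₃₂ ag₂₁ y y<m = trans (ag₃₂ y (<-≤-trans y<m m≤n)) (ag₂₁ y y<m)

module _ {A B : Set} (h : A → B) {V : ℕ} where

  update-agree : ∀ {I J} x {a b} → AgreeBelow V (h ∘ I) J → h a ≡ b →
                 AgreeBelow V (h ∘ update I x a) (update J x b)
  update-agree x ag ha≡b y y<V with y ≡ᵇ x
  ... | true  = ha≡b
  ... | false = ag y y<V

  updates-agree : ∀ {n I J} (xs : Vec Var n) {as bs} → AgreeBelow V (h ∘ I) J → map h as ≡ bs →
                  AgreeBelow V (h ∘ updates I xs as) (updates J xs bs)
  updates-agree [] {[]} {[]} ag _ = ag
  updates-agree (x ∷ xs) {_ ∷ _} {_ ∷ _} ag has≡bs =
    updates-agree xs (update-agree x ag (proj₁ (∷-injective has≡bs))) (proj₂ (∷-injective has≡bs))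

  map-agree : ∀ {n I J} {xs : Vec Var n} → AgreeBelow V (h ∘ I) J → VecAll (_< V) xs → map h (map I xs) ≡ map J xs
  map-agree ag [] = refl
  map-agree ag (x<V ∷ xs<V) = cong₂ _∷_ (ag _ x<V) (map-agree ag xs<V)

∘-updates : ∀ {A B : Set} {m} (h : A → B) (I : Var → A) (xs : Vec Var m) as y →
            h (updates I xs as y) ≡ updates (h ∘ I) xs (map h as) y
∘-updates h I xs as y = updates-agree h xs (λ _ _ → refl) refl y (n<1+n y)

VarsBelow : ℕ → Formula → Set
VarsBelow V (rel R xs)         = VecAll (_< V) xs
VarsBelow V (eq x y)           = x < V × y < V
VarsBelow V (φ ∨' ψ)           = VarsBelow V φ × VarsBelow V ψ
VarsBelow V (φ ∧' ψ)           = VarsBelow V φ × VarsBelow V ψ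
VarsBelow V (ex x φ)           = VarsBelow V φ
VarsBelow V (tc k χ v w x y _) = VecAll (_< V) x × VecAll (_< V) y × VarsBelow V χ

VecAll-<-mono : ∀ {n V W} {xs : Vec ℕ n} → V ≤ W → VecAll (_< V) xs → VecAll (_< W) xs
VecAll-<-mono V≤W = VecAll.map (λ x<V → <-≤-trans x<V V≤W)

VarsBelow-mono : ∀ {V W} φ → V ≤ W → VarsBelow V φ → VarsBelow W φ
VarsBelow-mono (rel R xs)         V≤W xs<V = VecAll-<-mono V≤W xs<V
VarsBelow-mono (eq x y)           V≤W (x<V , y<V) = <-≤-trans x<V V≤W , <-≤-trans y<V V≤W
VarsBelow-mono (φ ∨' ψ)           V≤W (φ<V , ψ<V) = VarsBelow-mono φ V≤W φ<V , VarsBelow-mono ψ V≤W ψ<V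
VarsBelow-mono (φ ∧' ψ)           V≤W (φ<V , ψ<V) = VarsBelow-mono φ V≤W φ<V , VarsBelow-mono ψ V≤W ψ<V
VarsBelow-mono (ex x φ)           V≤W φ<V = VarsBelow-mono φ V≤W φ<V
VarsBelow-mono (tc k χ v w x y _) V≤W (x<V , y<V , χ<V) =
  VecAll-<-mono V≤W x<V , VecAll-<-mono V≤W y<V , VarsBelow-mono χ V≤W χ<V

vecBound : ∀ {n} → Vec ℕ n → ℕ
vecBound []       = 0
vecBound (x ∷ xs) = suc x ⊔ vecBound xs

vecBound-sound : ∀ {n} (xs : Vec ℕ n) → VecAll (_< vecBound xs) xs
vecBound-sound []       = []
vecBound-sound (x ∷ xs) = m≤m⊔n (suc x) (vecBound xs) ∷ VecAll-<-mono (m≤n⊔m (suc x) _) (vecBound-sound xs)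

varBound : Formula → ℕ
varBound (rel R xs)         = vecBound xs
varBound (eq x y)           = suc x ⊔ suc y
varBound (φ ∨' ψ)           = varBound φ ⊔ varBound ψ
varBound (φ ∧' ψ)           = varBound φ ⊔ varBound ψ
varBound (ex x φ)           = varBound φ
varBound (tc k χ v w x y _) = vecBound x ⊔ vecBound y ⊔ varBound χ

varBound-sound : ∀ φ → VarsBelow (varBound φ) φ
varBound-sound (rel R xs) = vecBound-sound xs
varBound-sound (eq x y)   = m≤m⊔n (suc x) (suc y) , m≤n⊔m (suc x) (suc y)
varBound-sound (φ ∨' ψ)   = VarsBelow-mono φ (m≤m⊔n _ _) (varBound-sound φ) , VarsBelow-mono ψ (m≤n⊔m _ _) (varBound-sound ψ)
varBound-sound (φ ∧' ψ)   = VarsBelow-mono φ (m≤m⊔n _ _) (varBound-sound φ) , VarsBelow-mono ψ (m≤n⊔m _ _) (varBound-sound ψ)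
varBound-sound (ex x φ)   = varBound-sound φ
varBound-sound (tc k χ v w x y _) =
  VecAll-<-mono (≤-trans (m≤m⊔n (vecBound x) _) (m≤m⊔n _ (varBound χ))) (vecBound-sound x) ,
  VecAll-<-mono (≤-trans (m≤n⊔m (vecBound x) _) (m≤m⊔n _ (varBound χ))) (vecBound-sound y) ,
  VarsBelow-mono χ (m≤n⊔m _ _) (varBound-sound χ)

IsHomomorphism : (𝔄 𝔅 : Structure) → (Carrier 𝔄 → Carrier 𝔅) → Set
IsHomomorphism 𝔄 𝔅 h = ∀ R ts → interp 𝔄 R ts → interp 𝔅 R (map h ts)

TCStep : (𝔄 : Structure) → Assignment 𝔄 → ∀ {k} → Vec Var (suc k + suc k) → Formula →
         Vec (Carrier 𝔄) (suc k) → Vec (Carrier 𝔄) (suc k) → Set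
TCStep 𝔄 I vw χ as bs = Sat 𝔄 (updates I vw (as ++ bs)) χ

module _ {𝔄 𝔅 : Structure} {h : Carrier 𝔄 → Carrier 𝔅} (hom : IsHomomorphism 𝔄 𝔅 h) {V : ℕ} where

  Sat-hom : ∀ φ {I J} → VarsBelow V φ → AgreeBelow V (h ∘ I) J → Sat 𝔄 I φ → Sat 𝔅 J φ
  Sat-hom (rel R xs) xs<V ag Rxs = subst (interp 𝔅 R) (map-agree h ag xs<V) (hom R _ Rxs)
  Sat-hom (eq x y) (x<V , y<V) ag x≡y = trans (sym (ag x x<V)) (trans (cong h x≡y) (ag y y<V))
  Sat-hom (φ ∨' ψ) (φ<V , _) ag (inj₁ ⊨φ) = inj₁ (Sat-hom φ φ<V ag ⊨φ)
  Sat-hom (φ ∨' ψ) (_ , ψ<V) ag (inj₂ ⊨ψ) = inj₂ (Sat-hom ψ ψ<V ag ⊨ψ)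
  Sat-hom (φ ∧' ψ) (φ<V , ψ<V) ag (⊨φ , ⊨ψ) = Sat-hom φ φ<V ag ⊨φ , Sat-hom ψ ψ<V ag ⊨ψ
  Sat-hom (ex x φ) φ<V ag (a , ⊨φ) = h a , Sat-hom φ φ<V (update-agree h x ag refl) ⊨φ
  Sat-hom (tc k χ v w x y _) (x<V , y<V , χ<V) ag path =
    subst₂ (Star _) (map-agree h ag x<V) (map-agree h ag y<V) (gmap (map h) (λ {as} {bs} → hom-step {as} {bs}) path)
    where
    hom-step : ∀ {as bs : Vec (Carrier 𝔄) (suc k)} → TCStep 𝔄 _ (v ++ w) χ as bs → TCStep 𝔅 _ (v ++ w) χ (map h as) (map h bs)
    hom-step {as} {bs} = Sat-hom χ χ<V (updates-agree h (v ++ w) ag (map-++ h as bs))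

Sat-cong : ∀ {𝔄} φ {I J : Assignment 𝔄} → (∀ y → I y ≡ J y) → Sat 𝔄 I φ → Sat 𝔄 J φ
Sat-cong {𝔄} φ I≗J = Sat-hom {h = id} (λ R ts → subst (interp 𝔄 R) (sym (map-id ts))) φ (varBound-sound φ) (λ y _ → I≗J y)

-- Unfoldings and canonical models

Unfolding : Formula → Set
Unfolding (rel R xs)         = ⊤
Unfolding (eq x y)           = ⊤
Unfolding (φ ∨' ψ)           = Unfolding φ ⊎ Unfolding ψ
Unfolding (φ ∧' ψ)           = Unfolding φ × Unfolding ψ
Unfolding (ex x φ)           = Unfolding φ
Unfolding (tc k χ v w x y _) = List (Unfolding χ)

Atom : Set
Atom = Σ Sym λ R → Vec ℕ (arity R)

record Query : Set where
  constructor query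
  field
    atoms     : List Atom
    equations : List (ℕ × ℕ)
    next      : ℕ
open Query public

infixr 5 _⊗_

_⊗_ : Query → Query → Query
q ⊗ q′ = query (atoms q List.++ atoms q′) (equations q List.++ equations q′) (next q′)

fresh : (m n : ℕ) → Vec ℕ m
fresh zero    n = []
fresh (suc m) n = n ∷ fresh m (suc n)

-- The conjunctive query of an unfolding: ρ sends the variables of φ to positions, and positions from n on are fresh.
mutual
  unfold : (φ : Formula) → Unfolding φ → (Var → ℕ) → ℕ → Query
  unfold (rel R xs)         _        ρ n = query ((R , map ρ xs) ∷ []) [] n
  unfold (eq x y)           _        ρ n = query [] ((ρ x , ρ y) ∷ []) n
  unfold (φ ∨' ψ)           (inj₁ s) ρ n = unfold φ s ρ n
  unfold (φ ∨' ψ)           (inj₂ s) ρ n = unfold ψ s ρ n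
  unfold (φ ∧' ψ)           (s , t)  ρ n = let q = unfold φ s ρ n in q ⊗ unfold ψ t ρ (next q)
  unfold (ex x φ)           s        ρ n = unfold φ s (update ρ x n) (suc n)
  unfold (tc k χ v w x y _) ss       ρ n = unfoldSteps k χ (v ++ w) ρ (map ρ y) ss (map ρ x) n

  -- χ-steps from the positions `from` through fresh tuples, the last one equated with `to`
  unfoldSteps : ∀ k χ → Vec Var (suc k + suc k) → (Var → ℕ) → (to : Vec ℕ (suc k)) →
                List (Unfolding χ) → (from : Vec ℕ (suc k)) → ℕ → Query
  unfoldSteps k χ vw ρ to []       from n = query [] (toList (zip from to)) n
  unfoldSteps k χ vw ρ to (s ∷ ss) from n =
    let q = unfold χ s (updates ρ vw (from ++ fresh (suc k) n)) (n + suc k)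
    in q ⊗ unfoldSteps k χ vw ρ to ss (fresh (suc k) n) (next q)

AtomBelow : ℕ → Atom → Set
AtomBelow N (_ , xs) = VecAll (_< N) xs

PairBelow : ℕ → ℕ × ℕ → Set
PairBelow N (a , b) = a < N × b < N

record ScopedFrom (n : ℕ) (q : Query) : Set where
  field
    ≤next           : n ≤ next q
    atoms-below     : All (AtomBelow (next q)) (atoms q)
    equations-below : All (PairBelow (next q)) (equations q)
open ScopedFrom public

ScopedFrom-weaken : ∀ {m n q} → m ≤ n → ScopedFrom n q → ScopedFrom m q
ScopedFrom-weaken m≤n sq = record { ≤next = ≤-trans m≤n (≤next sq) ; atoms-below = atoms-below sq ; equations-below = equations-below sq }

RangeBelow : ℕ → (Var → ℕ) → Set
RangeBelow n ρ = ∀ y → ρ y < n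

⊗-scoped : ∀ {n q q′} → ScopedFrom n q → ScopedFrom (next q) q′ → ScopedFrom n (q ⊗ q′)
⊗-scoped sq sq′ = record
  { ≤next           = ≤-trans (≤next sq) (≤next sq′)
  ; atoms-below     = ++⁺ (All.map (VecAll-<-mono (≤next sq′)) (atoms-below sq)) (atoms-below sq′)
  ; equations-below = ++⁺ (All.map (λ (a< , b<) → <-≤-trans a< (≤next sq′) , <-≤-trans b< (≤next sq′)) (equations-below sq))
                          (equations-below sq′)
  }

update-pres : ∀ {A : Set} (P : A → Set) {ρ : Var → A} x {a} → (∀ y → P (ρ y)) → P a → ∀ y → P (update ρ x a y)
update-pres P x Pρ Pa y with y ≡ᵇ x
... | true  = Pa
... | false = Pρ y

updates-pres : ∀ {A : Set} {m} (P : A → Set) {ρ : Var → A} (xs : Vec Var m) {as} → (∀ y → P (ρ y)) → VecAll P as →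
               ∀ y → P (updates ρ xs as y)
updates-pres P []       Pρ []          = Pρ
updates-pres P (x ∷ xs) Pρ (Pa ∷ Pas) = updates-pres P xs (update-pres P x Pρ Pa) Pas

fresh-< : ∀ m n → VecAll (_< n + m) (fresh m n)
fresh-< zero    n = []
fresh-< (suc m) n rewrite +-suc n m = m≤m+n (suc n) m ∷ fresh-< m (suc n)

map-below : ∀ {m n} (ρ : Var → ℕ) → RangeBelow n ρ → (xs : Vec Var m) → VecAll (_< n) (map ρ xs)
map-below ρ ρ<n []       = []
map-below ρ ρ<n (x ∷ xs) = ρ<n x ∷ map-below ρ ρ<n xs

zip-below : ∀ {m N} {xs ys : Vec ℕ m} → VecAll (_< N) xs → VecAll (_< N) ys → All (PairBelow N) (toList (zip xs ys))
zip-below []            []            = []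
zip-below (x<N ∷ xs<N) (y<N ∷ ys<N) = (x<N , y<N) ∷ zip-below xs<N ys<N

mutual
  unfold-scoped : ∀ φ s {ρ n} → RangeBelow n ρ → ScopedFrom n (unfold φ s ρ n)
  unfold-scoped (rel R xs) _ {ρ} ρ<n = record { ≤next = ≤-refl ; atoms-below = map-below ρ ρ<n xs ∷ [] ; equations-below = [] }
  unfold-scoped (eq x y)   _ ρ<n = record { ≤next = ≤-refl ; atoms-below = [] ; equations-below = (ρ<n x , ρ<n y) ∷ [] }
  unfold-scoped (φ ∨' ψ) (inj₁ s) ρ<n = unfold-scoped φ s ρ<n
  unfold-scoped (φ ∨' ψ) (inj₂ s) ρ<n = unfold-scoped ψ s ρ<n
  unfold-scoped (φ ∧' ψ) (s , t) ρ<n =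
    let sq = unfold-scoped φ s ρ<n in ⊗-scoped sq (unfold-scoped ψ t (λ y → <-≤-trans (ρ<n y) (≤next sq)))
  unfold-scoped (ex x φ) s {n = n} ρ<n =
    let sq = unfold-scoped φ s (update-pres (_< suc n) x (λ y → m<n⇒m<1+n (ρ<n y)) (n<1+n n))
    in ScopedFrom-weaken (n≤1+n n) sq
  unfold-scoped (tc k χ v w x y _) ss {ρ} ρ<n =
    unfoldSteps-scoped k χ (v ++ w) ss ρ<n (map-below ρ ρ<n y) (map-below ρ ρ<n x)

  unfoldSteps-scoped : ∀ k χ vw ss {ρ to from n} → RangeBelow n ρ → VecAll (_< n) to → VecAll (_< n) from →
                       ScopedFrom n (unfoldSteps k χ vw ρ to ss from n)
  unfoldSteps-scoped k χ vw [] ρ<n to<n from<n =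
    record { ≤next = ≤-refl ; atoms-below = [] ; equations-below = zip-below from<n to<n }
  unfoldSteps-scoped k χ vw (s ∷ ss) {ρ} {to} {from} {n} ρ<n to<n from<n =
    ScopedFrom-weaken n≤n′ sq⊗
    where
    n′ = n + suc k
    n≤n′ : n ≤ n′
    n≤n′ = m≤m+n n (suc k)
    sq = unfold-scoped χ s {n = n′}
           (updates-pres (_< n′) vw (λ y → <-≤-trans (ρ<n y) n≤n′)
             (VecAll-++⁺ (VecAll-<-mono n≤n′ from<n) (fresh-< (suc k) n)))
    n≤next = ≤-trans n≤n′ (≤next sq)
    sq⊗ = ⊗-scoped sq (unfoldSteps-scoped k χ vw ss (λ y → <-≤-trans (ρ<n y) n≤next)
                         (VecAll-<-mono n≤next to<n) (VecAll-<-mono (≤next sq) (fresh-< (suc k) n)))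

representative : List (ℕ × ℕ) → ℕ → ℕ
representative []            x = x
representative ((a , b) ∷ E) x = if representative E x ≡ᵇ representative E a then representative E b else representative E x

representative-identifies : ∀ E {a b} → (a , b) ∈ E → representative E a ≡ representative E b
representative-identifies ((a , b) ∷ E) (here refl)
  with representative E a ≡ᵇ representative E a | ≡⇒≡ᵇ (representative E a) _ refl
... | true | _ = sym (if-eta (representative E b ≡ᵇ representative E a))
representative-identifies ((a′ , b′) ∷ E) (there ab∈E) =
  cong (λ r → if r ≡ᵇ representative E a′ then representative E b′ else r) (representative-identifies E ab∈E)

Solves : {C : Set} → (ℕ → C) → List (ℕ × ℕ) → Set
Solves g E = All (λ (a , b) → g a ≡ g b) E

representative-solved : ∀ {C : Set} (g : ℕ → C) E → Solves g E → ∀ x → g (representative E x) ≡ g x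
representative-solved g []            []              x = refl
representative-solved g ((a , b) ∷ E) (ga≡gb ∷ solves) x
  with representative E x ≡ᵇ representative E a | ≡ᵇ⇒≡ (representative E x) (representative E a)
... | false | _   = representative-solved g E solves x
... | true  | rx≡ra = begin
  g (representative E b) ≡⟨ representative-solved g E solves b ⟩
  g b                    ≡⟨ sym ga≡gb ⟩
  g a                    ≡⟨ sym (representative-solved g E solves a) ⟩
  g (representative E a) ≡⟨ cong g (sym (rx≡ra _)) ⟩
  g (representative E x) ≡⟨ representative-solved g E solves x ⟩
  g x                    ∎
  where open ≡-Reasoning

representative-< : ∀ {N} E → All (PairBelow N) E → ∀ {x} → x < N → representative E x < N
representative-< []            []                 x<N = x<N
representative-< ((a , b) ∷ E) ((_ , b<N) ∷ E<N) {x} x<N with representative E x ≡ᵇ representative E a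
... | true  = representative-< E E<N b<N
... | false = representative-< E E<N x<N

infix 4 _⊆Q_

record _⊆Q_ (q′ q : Query) : Set where
  constructor subquery
  field
    atoms-⊆     : atoms q′ ⊆ atoms q
    equations-⊆ : equations q′ ⊆ equations q

⊗-⊆Qˡ : ∀ q₁ q₂ {q} → q₁ ⊗ q₂ ⊆Q q → q₁ ⊆Q q
⊗-⊆Qˡ q₁ q₂ (subquery as⊆ es⊆) =
  subquery (as⊆ ∘ xs⊆xs++ys (atoms q₁) (atoms q₂)) (es⊆ ∘ xs⊆xs++ys (equations q₁) (equations q₂))

⊗-⊆Qʳ : ∀ q₁ q₂ {q} → q₁ ⊗ q₂ ⊆Q q → q₂ ⊆Q q
⊗-⊆Qʳ q₁ q₂ (subquery as⊆ es⊆) =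
  subquery (as⊆ ∘ xs⊆ys++xs (atoms q₂) (atoms q₁)) (es⊆ ∘ xs⊆ys++xs (equations q₂) (equations q₁))

-- Positions are identified through their representatives; positions at or beyond next q are junk, wrapping around.
module Canonical (q : Query) where

  Element : Set
  Element = Fin (suc (next q))

  [_] : ℕ → Element
  [ n ] = representative (equations q) n mod suc (next q)

  toℕ-[] : All (PairBelow (next q)) (equations q) → ∀ {n} → n < next q → toℕ [ n ] ≡ representative (equations q) n
  toℕ-[] E<next n<next = trans (toℕ-fromℕ< _) (m<n⇒m%n≡m (m<n⇒m<1+n (representative-< (equations q) E<next n<next)))

  imageAtom : Atom → Σ Sym λ R → Vec Element (arity R)
  imageAtom (R , xs) = R , map [_] xs

  structure : Structure
  structure = record
    { Carrier   = Element
    ; enum      = _mod suc (next q)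
    ; enum-surj = λ i → toℕ i , λ { refl → toℕ-injective (trans (toℕ-fromℕ< _) (m<n⇒m%n≡m (toℕ<n i))) }
    ; interp    = λ R ts → (R , ts) ∈ List.map imageAtom (atoms q)
    }

  zip-identified : ∀ {m} (xs ys : Vec ℕ m) → toList (zip xs ys) ⊆ equations q → map [_] xs ≡ map [_] ys
  zip-identified []       []       _  = refl
  zip-identified (x ∷ xs) (y ∷ ys) ⊆E =
    cong₂ _∷_ (cong (_mod suc (next q)) (representative-identifies (equations q) (⊆E (here refl))))
              (zip-identified xs ys (⊆E ∘ there))

  mutual
    unfold-sound : ∀ φ s ρ n → unfold φ s ρ n ⊆Q q → Sat structure ([_] ∘ ρ) φ
    unfold-sound (rel R xs) _ ρ n (subquery as⊆ _) =
      subst (λ ts → (R , ts) ∈ List.map imageAtom (atoms q)) (sym (map-∘ [_] ρ xs)) (∈-map⁺ imageAtom (as⊆ (here refl)))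
    unfold-sound (eq x y)   _ ρ n (subquery _ es⊆) = cong (_mod suc (next q)) (representative-identifies (equations q) (es⊆ (here refl)))
    unfold-sound (φ ∨' ψ) (inj₁ s) ρ n ⊆q = inj₁ (unfold-sound φ s ρ n ⊆q)
    unfold-sound (φ ∨' ψ) (inj₂ s) ρ n ⊆q = inj₂ (unfold-sound ψ s ρ n ⊆q)
    unfold-sound (φ ∧' ψ) (s , t)  ρ n ⊆q =
      unfold-sound φ s ρ n (⊗-⊆Qˡ q₁ q₂ ⊆q) , unfold-sound ψ t ρ (next q₁) (⊗-⊆Qʳ q₁ q₂ ⊆q)
      where
      q₁ = unfold φ s ρ n
      q₂ = unfold ψ t ρ (next q₁)
    unfold-sound (ex x φ) s ρ n ⊆q =
      [ n ] , Sat-cong φ (∘-updates [_] ρ (x ∷ []) (n ∷ [])) (unfold-sound φ s (update ρ x n) (suc n) ⊆q)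
    unfold-sound (tc k χ v w x y _) ss ρ n ⊆q =
      subst₂ (Star _) (sym (map-∘ [_] ρ x)) (sym (map-∘ [_] ρ y)) (unfoldSteps-sound k χ (v ++ w) ρ (map ρ y) ss (map ρ x) n ⊆q)

    unfoldSteps-sound : ∀ k χ vw ρ to ss from n → unfoldSteps k χ vw ρ to ss from n ⊆Q q →
      Star (TCStep structure ([_] ∘ ρ) vw χ) (map [_] from) (map [_] to)
    unfoldSteps-sound k χ vw ρ to [] from n (subquery _ es⊆) =
      subst (Star (TCStep structure ([_] ∘ ρ) vw χ) _) (zip-identified from to es⊆) ε
    unfoldSteps-sound k χ vw ρ to (s ∷ ss) from n ⊆q = first ◅ unfoldSteps-sound k χ vw ρ to ss nx (next q₁) (⊗-⊆Qʳ q₁ q₂ ⊆q)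
      where
      nx = fresh (suc k) n
      ρ′ = updates ρ vw (from ++ nx)
      q₁ = unfold χ s ρ′ (n + suc k)
      q₂ = unfoldSteps k χ vw ρ to ss nx (next q₁)
      first : TCStep structure ([_] ∘ ρ) vw χ (map [_] from) (map [_] nx)
      first = Sat-cong χ (λ z → trans (∘-updates [_] ρ vw (from ++ nx) z) (cong (λ as → updates ([_] ∘ ρ) vw as z) (map-++ [_] from nx)))
               (unfold-sound χ s ρ′ (n + suc k) (⊗-⊆Qˡ q₁ q₂ ⊆q))

module _ {C : Set} where

  updates-fresh-below : ∀ m n (g : ℕ → C) cs → AgreeBelow n (updates g (fresh m n) cs) g
  updates-fresh-below zero    n g []       y y<n = refl
  updates-fresh-below (suc m) n g (c ∷ cs) y y<n =
    trans (updates-fresh-below m (suc n) (update g n c) cs y (m<n⇒m<1+n y<n)) (update-≢ g n c (λ { refl → <-irrefl refl y<n }))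

  map-updates-fresh : ∀ m n (g : ℕ → C) cs → map (updates g (fresh m n) cs) (fresh m n) ≡ cs
  map-updates-fresh zero    n g []       = refl
  map-updates-fresh (suc m) n g (c ∷ cs) =
    cong₂ _∷_ (trans (updates-fresh-below m (suc n) (update g n c) cs n (n<1+n n)) (update-≡ g n c))
              (map-updates-fresh m (suc n) (update g n c) cs)

  map-below-agree : ∀ {m N} {g′ g : ℕ → C} → AgreeBelow N g′ g → {xs : Vec ℕ m} → VecAll (_< N) xs → map g′ xs ≡ map g xs
  map-below-agree ag []            = refl
  map-below-agree ag (x<N ∷ xs<N) = cong₂ _∷_ (ag _ x<N) (map-below-agree ag xs<N)

  zip-solved : ∀ {m} (g : ℕ → C) (xs ys : Vec ℕ m) → map g xs ≡ map g ys → Solves g (toList (zip xs ys))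
  zip-solved g []       []       _  = []
  zip-solved g (x ∷ xs) (y ∷ ys) gxs≡gys = proj₁ (∷-injective gxs≡gys) ∷ zip-solved g xs ys (proj₂ (∷-injective gxs≡gys))

module _ (𝔄 : Structure) where

  infix 4 _⊨Q_

  record _⊨Q_ (g : ℕ → Carrier 𝔄) (q : Query) : Set where
    constructor models
    field
      atoms-hold     : All (λ (R , xs) → interp 𝔄 R (map g xs)) (atoms q)
      equations-hold : Solves g (equations q)
  open _⊨Q_ public

  ⊨Q-⊗ : ∀ {n q₁ q₂ g′ g} → ScopedFrom n q₁ → AgreeBelow (next q₁) g′ g →
         g ⊨Q q₁ → g′ ⊨Q q₂ → g′ ⊨Q q₁ ⊗ q₂
  ⊨Q-⊗ sq ag (models as es) (models as′ es′) = models
    (++⁺ (All.zipWith (λ (xs<next , Rxs) → subst (interp 𝔄 _) (sym (map-below-agree ag xs<next)) Rxs) (atoms-below sq , as)) as′)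
    (++⁺ (All.zipWith (λ ((a< , b<) , ga≡gb) → trans (ag _ a<) (trans ga≡gb (sym (ag _ b<)))) (equations-below sq , es)) es′)

  record Realizes {S : Set} (Q : S → Query) (n : ℕ) (g : ℕ → Carrier 𝔄) : Set where
    constructor realized
    field
      choice    : S
      valuation : ℕ → Carrier 𝔄
      extends   : AgreeBelow n valuation g
      satisfies : valuation ⊨Q Q choice

  module _ {V : ℕ} where

    mutual
      realize : ∀ φ {J} → VarsBelow V φ → Sat 𝔄 J φ → ∀ {ρ n g} → RangeBelow n ρ → AgreeBelow V (g ∘ ρ) J →
                Realizes (λ s → unfold φ s ρ n) n g
      realize (rel R xs) {J} xs<V Rxs {ρ} {g = g} ρ<n ag =
        realized tt g (λ _ _ → refl) (models (subst (interp 𝔄 R) (sym (map-agree g ag xs<V)) Rxs ∷ []) [])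
      realize (eq x y) (x<V , y<V) x≡y {g = g} ρ<n ag =
        realized tt g (λ _ _ → refl) (models [] (trans (ag x x<V) (trans x≡y (sym (ag y y<V))) ∷ []))
      realize (φ ∨' ψ) (φ<V , _) (inj₁ ⊨φ) {g = g} ρ<n ag =
        let realized s g′ ext sat = realize φ φ<V ⊨φ {g = g} ρ<n ag in realized (inj₁ s) g′ ext sat
      realize (φ ∨' ψ) (_ , ψ<V) (inj₂ ⊨ψ) {g = g} ρ<n ag =
        let realized s g′ ext sat = realize ψ ψ<V ⊨ψ {g = g} ρ<n ag in realized (inj₂ s) g′ ext sat
      realize (φ ∧' ψ) (φ<V , ψ<V) (⊨φ , ⊨ψ) {ρ} {n} {g} ρ<n ag =
        realized (s , t) g₂ (AgreeBelow-trans (≤next sq) ext₂ ext₁) (⊨Q-⊗ sq ext₂ sat₁ sat₂)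
        where
        open Realizes (realize φ φ<V ⊨φ {g = g} ρ<n ag) renaming (choice to s; valuation to g₁; extends to ext₁; satisfies to sat₁)
        sq = unfold-scoped φ s ρ<n
        open Realizes (realize ψ ψ<V ⊨ψ {g = g₁} (λ y → <-≤-trans (ρ<n y) (≤next sq))
                                              (λ y y<V → trans (ext₁ (ρ y) (ρ<n y)) (ag y y<V)))
          renaming (choice to t; valuation to g₂; extends to ext₂; satisfies to sat₂)
      realize (ex x φ) {J} φ<V (a , ⊨φ) {ρ} {n} {g} ρ<n ag =
        let realized s g′ ext sat = realize φ φ<V ⊨φ {g = update g n a} ρ′<suc-n ag′
        in realized s g′ (AgreeBelow-trans (n≤1+n n) ext (λ y y<n → update-≢ g n a (λ { refl → <-irrefl refl y<n }))) sat
        where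
        ρ′<suc-n : RangeBelow (suc n) (update ρ x n)
        ρ′<suc-n = update-pres (_< suc n) x (λ y → m<n⇒m<1+n (ρ<n y)) (n<1+n n)
        ag′ : AgreeBelow V (update g n a ∘ update ρ x n) (update J x a)
        ag′ y y<V with y ≡ᵇ x
        ... | true  = update-≡ g n a
        ... | false = trans (update-≢ g n a (λ { refl → <-irrefl refl (ρ<n y) })) (ag y y<V)
      realize (tc k χ v w x y _) (x<V , y<V , χ<V) path {ρ} {g = g} ρ<n ag =
        realizeSteps k χ (v ++ w) χ<V path {g = g} ρ<n (map-below ρ ρ<n x) (map-below ρ ρ<n y) ag (map-agree g ag x<V) (map-agree g ag y<V)

      realizeSteps : ∀ k χ vw → VarsBelow V χ → ∀ {J ρ to as bs} → Star (TCStep 𝔄 J vw χ) as bs →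
                     ∀ {from n g} → RangeBelow n ρ → VecAll (_< n) from → VecAll (_< n) to →
                     AgreeBelow V (g ∘ ρ) J → map g from ≡ as → map g to ≡ bs →
                     Realizes (λ ss → unfoldSteps k χ vw ρ to ss from n) n g
      realizeSteps k χ vw χ<V ε {from = from} {g = g} ρ<n from<n to<n ag from↦as to↦bs =
        realized [] g (λ _ _ → refl) (models [] (zip-solved g from _ (trans from↦as (sym to↦bs))))
      realizeSteps k χ vw χ<V {J} {ρ} {to} {as} (_◅_ {j = cs} r p) {from} {n} {g} ρ<n from<n to<n ag from↦as to↦bs =
        realized (s ∷ ss) g₃ (AgreeBelow-trans n≤n′ (AgreeBelow-trans (≤next sq) ext₃ ext₂) ext₁) (⊨Q-⊗ sq ext₃ sat₂ sat₃)
        where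
        nx = fresh (suc k) n
        n′ = n + suc k
        n≤n′ = m≤m+n n (suc k)
        g₁ = updates g nx cs
        ext₁ : AgreeBelow n g₁ g
        ext₁ = updates-fresh-below (suc k) n g cs
        ρ′ = updates ρ vw (from ++ nx)
        ρ′<n′ : RangeBelow n′ ρ′
        ρ′<n′ = updates-pres (_< n′) vw (λ y → <-≤-trans (ρ<n y) n≤n′)
                             (VecAll-++⁺ (VecAll-<-mono n≤n′ from<n) (fresh-< (suc k) n))
        from++nx↦as++cs : map g₁ (from ++ nx) ≡ as ++ cs
        from++nx↦as++cs = trans (map-++ g₁ from nx)
          (cong₂ _++_ (trans (map-below-agree ext₁ from<n) from↦as) (map-updates-fresh (suc k) n g cs))
        open Realizes (realize χ χ<V r {g = g₁} ρ′<n′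
                         (updates-agree g₁ vw (λ y y<V → trans (ext₁ (ρ y) (ρ<n y)) (ag y y<V)) from++nx↦as++cs))
          renaming (choice to s; valuation to g₂; extends to ext₂; satisfies to sat₂)
        sq = unfold-scoped χ s ρ′<n′
        n≤next = ≤-trans n≤n′ (≤next sq)
        ext₂₀ : AgreeBelow n g₂ g
        ext₂₀ = AgreeBelow-trans n≤n′ ext₂ ext₁
        open Realizes (realizeSteps k χ vw χ<V p {g = g₂} (λ y → <-≤-trans (ρ<n y) n≤next)
                         (VecAll-<-mono (≤next sq) (fresh-< (suc k) n)) (VecAll-<-mono n≤next to<n) (λ y y<V → trans (ext₂₀ (ρ y) (ρ<n y)) (ag y y<V))
                         (trans (map-below-agree ext₂ (fresh-< (suc k) n)) (map-updates-fresh (suc k) n g cs))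
                         (trans (map-below-agree ext₂₀ to<n) to↦bs))
          renaming (choice to ss; valuation to g₃; extends to ext₃; satisfies to sat₃)

module CanonicalHom (q : Query) {n} (sq : ScopedFrom n q) {𝔄 : Structure} {g : ℕ → Carrier 𝔄} (g⊨q : _⊨Q_ 𝔄 g q) where
  open Canonical q

  h : Element → Carrier 𝔄
  h = g ∘ toℕ

  h-[] : ∀ {m} → m < next q → h [ m ] ≡ g m
  h-[] {m} m<next = trans (cong g (toℕ-[] (equations-below sq) m<next)) (representative-solved g (equations q) (equations-hold g⊨q) m)

  h∘[]-below : ∀ {m} {xs : Vec ℕ m} → VecAll (_< next q) xs → map h (map [_] xs) ≡ map g xs
  h∘[]-below []         = refl
  h∘[]-below (x< ∷ xs<) = cong₂ _∷_ (h-[] x<) (h∘[]-below xs<)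

  h-hom : IsHomomorphism structure 𝔄 h
  h-hom R ts Rts with (R , xs) , atom∈q , refl ← ∈-map⁻ imageAtom Rts =
    subst (interp 𝔄 R) (sym (h∘[]-below (All.lookup (atoms-below sq) atom∈q))) (All.lookup (atoms-hold g⊨q) atom∈q)

-- Deciding satisfaction in finite structures

Unique⇒length≤ : ∀ {A : Set} {xs ys : List A} → Unique xs → xs ⊆ ys → length xs ≤ length ys
Unique⇒length≤ {xs = []} [] xs⊆ys = z≤n
Unique⇒length≤ {xs = x ∷ xs} (x∉xs ∷ !xs) xs⊆ys with us , vs , refl ← ∈-∃++ (xs⊆ys (here refl)) =
  ≤-trans (s≤s (Unique⇒length≤ !xs xs⊆us++vs)) (≤-reflexive length-us++x∷vs)
  where
  xs⊆us++vs : xs ⊆ us List.++ vs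
  xs⊆us++vs a∈xs with ∈-++⁻ us (xs⊆ys (there a∈xs))
  ... | inj₁ a∈us        = ∈-++⁺ˡ a∈us
  ... | inj₂ (here refl) = contradiction a∈xs (All¬⇒¬Any x∉xs)
  ... | inj₂ (there a∈vs) = ∈-++⁺ʳ us a∈vs
  length-us++x∷vs : suc (length (us List.++ vs)) ≡ length (us List.++ x ∷ vs)
  length-us++x∷vs = trans (cong suc (length-++ us)) (trans (sym (+-suc (length us) (length vs))) (sym (length-++ us)))

module Reachability {A : Set} (_≟_ : DecidableEquality A) {R : A → A → Set} where

  open import Data.List.Membership.DecPropositional _≟_ using (_∈?_)

  visited : ∀ {x y} → Star R x y → List A
  visited ε = []
  visited (_◅_ {x} _ p) = x ∷ visited p

  SimplePath : A → A → Set
  SimplePath x y = Σ (Star R x y) (Unique ∘ visited)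

  suffixFrom : ∀ {x y z} (p : Star R z y) → x ∈ visited p → Unique (visited p) → SimplePath x y
  suffixFrom (r ◅ p) (here refl) !p = r ◅ p , !p
  suffixFrom (r ◅ p) (there x∈p) (_ ∷ !p) = suffixFrom p x∈p !p

  toSimplePath : ∀ {x y} → Star R x y → SimplePath x y
  toSimplePath ε = ε , []
  toSimplePath {x} (r ◅ p) with q , !q ← toSimplePath p | x ∈? visited q
  ... | yes x∈q = suffixFrom q x∈q !q
  ... | no  x∉q = r ◅ q , ¬Any⇒All¬ (visited q) x∉q ∷ !q

  PathWithin : ℕ → A → A → Set
  PathWithin n x y = Σ (Star R x y) (λ p → length (visited p) ≤ n)

  module _ (R? : ∀ a b → Dec (R a b)) (elements : List A) (complete : ∀ a → a ∈ elements) where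

    PathWithin? : ∀ n x y → Dec (PathWithin n x y)
    PathWithin? n x y with x ≟ y
    ... | yes refl = yes (ε , z≤n)
    PathWithin? zero x y | no x≢y = no λ { (ε , _) → x≢y refl ; (_ ◅ _ , ()) }
    PathWithin? (suc n) x y | no x≢y with any? (λ z → R? x z ×-dec PathWithin? n z y) elements
    ... | yes step with _ , r , p , p≤n ← satisfied step = yes (r ◅ p , s≤s p≤n)
    ... | no ¬step = no λ
      { (ε , _) → x≢y refl
      ; (_◅_ {j = z} r p , s≤s p≤n) → ¬step (Any.map (λ { refl → r , p , p≤n }) (complete z)) }

    -- a path visiting no node twice has at most |elements| steps
    Star? : ∀ x y → Dec (Star R x y)
    Star? x y with PathWithin? (length elements) x y
    ... | yes (p , _) = yes p
    ... | no ¬p = no λ p → let q , !q = toSimplePath p in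
      ¬p (q , Unique⇒length≤ !q (λ {a} _ → complete a))

vectors : ∀ {A : Set} → List A → (n : ℕ) → List (Vec A n)
vectors xs zero    = [] ∷ []
vectors xs (suc n) = cartesianProductWith _∷_ xs (vectors xs n)

vectors-complete : ∀ {A : Set} {xs : List A} → (∀ a → a ∈ xs) → ∀ {n} (as : Vec A n) → as ∈ vectors xs n
vectors-complete complete []       = here refl
vectors-complete complete (a ∷ as) = ∈-cartesianProductWith⁺ _∷_ (complete a) (vectors-complete complete as)

module FiniteSat (𝔄 : Structure) (_≟_ : DecidableEquality (Carrier 𝔄))
                 (elements : List (Carrier 𝔄)) (complete : ∀ a → a ∈ elements)
                 (interp? : ∀ R ts → Dec (interp 𝔄 R ts)) where

  Sat? : ∀ φ I → Dec (Sat 𝔄 I φ)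
  Sat? (rel R xs)         I = interp? R (map I xs)
  Sat? (eq x y)           I = I x ≟ I y
  Sat? (φ ∨' ψ)           I = Sat? φ I ⊎-dec Sat? ψ I
  Sat? (φ ∧' ψ)           I = Sat? φ I ×-dec Sat? ψ I
  Sat? (ex x φ)           I = map′ Any.satisfied (λ (a , ⊨φ) → Any.map (λ { refl → ⊨φ }) (complete a))
                                   (any? (λ a → Sat? φ (update I x a)) elements)
  Sat? (tc k χ v w x y _) I =
    Reachability.Star? (Vec.≡-dec _≟_) (λ as bs → Sat? χ (updates I (v ++ w) (as ++ bs)))
      (vectors elements (suc k)) (vectors-complete complete) (map I x) (map I y)

_≟Sym_ : DecidableEquality Sym
symbol a m ≟Sym symbol b n with a ℕ.≟ b | m ℕ.≟ n
... | yes refl | yes refl = yes refl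
... | no a≢b   | _        = no λ { refl → a≢b refl }
... | yes _    | no m≢n   = no λ { refl → m≢n refl }

module _ (q : Query) where
  open Canonical q

  private
    _≟El_ : DecidableEquality Element
    _≟El_ = Fin._≟_

  open import Data.List.Membership.DecPropositional (Product.≡-dec _≟Sym_ (λ {R} → Vec.≡-dec {n = arity R} _≟El_)) using (_∈?_)

  Sat-canonical? : ∀ φ I → Dec (Sat structure I φ)
  Sat-canonical? = FiniteSat.Sat? structure _≟El_ (allFin _) ∈-allFin (λ R ts → (R , ts) ∈? List.map imageAtom (atoms q))

-- Validity is Π⁰₁

listsUpTo : ∀ {S : Set} → List S → ℕ → List (List S)
listsUpTo X zero    = [] ∷ []
listsUpTo X (suc n) = [] ∷ cartesianProductWith _∷_ X (listsUpTo X n)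

listsUpTo-complete : ∀ {S : Set} {X : List S} {ss} → All (_∈ X) ss → ∀ {n} → length ss ≤ n → ss ∈ listsUpTo X n
listsUpTo-complete []             {zero}  _         = here refl
listsUpTo-complete []             {suc n} _         = here refl
listsUpTo-complete (s∈X ∷ ss⊆X) {suc n} (s≤s len≤n) = there (∈-cartesianProductWith⁺ _∷_ s∈X (listsUpTo-complete ss⊆X len≤n))

unfoldings : (φ : Formula) → ℕ → List (Unfolding φ)
unfoldings (rel _ _)          n = tt ∷ []
unfoldings (eq _ _)           n = tt ∷ []
unfoldings (φ ∨' ψ)           n = List.map inj₁ (unfoldings φ n) List.++ List.map inj₂ (unfoldings ψ n)
unfoldings (φ ∧' ψ)           n = cartesianProduct (unfoldings φ n) (unfoldings ψ n)
unfoldings (ex x φ)           n = unfoldings φ n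
unfoldings (tc k χ v w x y _) n = listsUpTo (unfoldings χ n) n

mutual
  size : ∀ φ → Unfolding φ → ℕ
  size (rel _ _)          _        = 0
  size (eq _ _)           _        = 0
  size (φ ∨' ψ)           (inj₁ s) = size φ s
  size (φ ∨' ψ)           (inj₂ s) = size ψ s
  size (φ ∧' ψ)           (s , t)  = size φ s ⊔ size ψ t
  size (ex x φ)           s        = size φ s
  size (tc k χ v w x y _) ss       = sizeSteps χ ss

  sizeSteps : ∀ χ → List (Unfolding χ) → ℕ
  sizeSteps χ []       = 0
  sizeSteps χ (s ∷ ss) = suc (size χ s ⊔ sizeSteps χ ss)

length≤sizeSteps : ∀ χ ss → length ss ≤ sizeSteps χ ss
length≤sizeSteps χ []       = z≤n
length≤sizeSteps χ (s ∷ ss) = s≤s (≤-trans (length≤sizeSteps χ ss) (m≤n⊔m (size χ s) _))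

size≤sizeSteps : ∀ χ ss → All (λ s → size χ s ≤ sizeSteps χ ss) ss
size≤sizeSteps χ []       = []
size≤sizeSteps χ (s ∷ ss) =
  m≤n⇒m≤1+n (m≤m⊔n (size χ s) _) ∷
  All.map (λ s≤ → m≤n⇒m≤1+n (≤-trans s≤ (m≤n⊔m (size χ s) _))) (size≤sizeSteps χ ss)

unfoldings-complete : ∀ φ s {n} → size φ s ≤ n → s ∈ unfoldings φ n
unfoldings-complete (rel _ _) tt _ = here refl
unfoldings-complete (eq _ _)  tt _ = here refl
unfoldings-complete (φ ∨' ψ) (inj₁ s) s≤n = ∈-++⁺ˡ (∈-map⁺ inj₁ (unfoldings-complete φ s s≤n))
unfoldings-complete (φ ∨' ψ) (inj₂ s) {n} s≤n =
  ∈-++⁺ʳ (List.map inj₁ (unfoldings φ n)) (∈-map⁺ inj₂ (unfoldings-complete ψ s s≤n))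
unfoldings-complete (φ ∧' ψ) (s , t) st≤n =
  ∈-cartesianProduct⁺ (unfoldings-complete φ s (≤-trans (m≤m⊔n _ _) st≤n)) (unfoldings-complete ψ t (≤-trans (m≤n⊔m _ _) st≤n))
unfoldings-complete (ex x φ) s s≤n = unfoldings-complete φ s s≤n
unfoldings-complete (tc k χ v w x y _) ss ss≤n =
  listsUpTo-complete (All.map (λ s≤ → unfoldings-complete χ _ (≤-trans s≤ ss≤n)) (size≤sizeSteps χ ss))
                     (≤-trans (length≤sizeSteps χ ss) ss≤n)

module Entailment (φ ψ : Formula) where

  B : ℕ
  B = varBound φ ⊔ varBound ψ

  ρ₀ : Var → ℕ
  ρ₀ y = y ⊓ B

  ρ₀<suc-B : RangeBelow (suc B) ρ₀
  ρ₀<suc-B y = s≤s (m⊓n≤n y B)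

  ρ₀-agree : ∀ {A : Set} (I : Var → A) → AgreeBelow (suc B) (I ∘ ρ₀) I
  ρ₀-agree I y y<V = cong I (m≤n⇒m⊓n≡m (≤-pred y<V))

  φ<V : VarsBelow (suc B) φ
  φ<V = VarsBelow-mono φ (m≤n⇒m≤1+n (m≤m⊔n _ _)) (varBound-sound φ)

  ψ<V : VarsBelow (suc B) ψ
  ψ<V = VarsBelow-mono ψ (m≤n⇒m≤1+n (m≤n⊔m _ _)) (varBound-sound ψ)

  canonicalQuery : Unfolding φ → Query
  canonicalQuery s = unfold φ s ρ₀ (suc B)

  CanonicallyHolds : Unfolding φ → Set
  CanonicallyHolds s = Sat (Canonical.structure (canonicalQuery s)) (Canonical.[_] (canonicalQuery s) ∘ ρ₀) ψ

  CanonicallyHolds? : ∀ s → Dec (CanonicallyHolds s)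
  CanonicallyHolds? s = Sat-canonical? (canonicalQuery s) ψ (Canonical.[_] (canonicalQuery s) ∘ ρ₀)

  entails≤? : ℕ → Bool
  entails≤? n = isYes (all? CanonicallyHolds? (unfoldings φ n))

  valid⇒entails≤ : ValidImp φ ψ → ∀ n → entails≤? n ≡ true
  valid⇒entails≤ valid n = Equivalence.to T-≡ (fromWitness (All.tabulate λ {s} _ →
    valid _ _ (Canonical.unfold-sound (canonicalQuery s) φ s ρ₀ (suc B) (subquery (λ a∈ → a∈) (λ e∈ → e∈)))))

  entails≤⇒valid : (∀ n → entails≤? n ≡ true) → ValidImp φ ψ
  entails≤⇒valid entails 𝔄 I ⊨φ = Sat-hom h-hom ψ ψ<V h∘[]∘ρ₀≗I holds
    where
    open Realizes (realize 𝔄 φ φ<V ⊨φ {g = I} ρ₀<suc-B (ρ₀-agree I)) renaming (choice to s; valuation to g)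
    sq = unfold-scoped φ s ρ₀<suc-B
    open Canonical (canonicalQuery s) using ([_])
    open CanonicalHom (canonicalQuery s) sq satisfies using (h; h-[]; h-hom)
    holds : CanonicallyHolds s
    holds = All.lookup (toWitness (Equivalence.from T-≡ (entails (size φ s)))) (unfoldings-complete φ s ≤-refl)
    h∘[]∘ρ₀≗I : AgreeBelow (suc B) (h ∘ [_] ∘ ρ₀) I
    h∘[]∘ρ₀≗I y y<V =
      trans (h-[] (<-≤-trans (ρ₀<suc-B y) (≤next sq))) (trans (extends (ρ₀ y) (ρ₀<suc-B y)) (ρ₀-agree I y y<V))

membership : Σ (Formula → Formula → ℕ → Bool) λ R → (φ ψ : Formula) → ValidImp φ ψ ⇔ ((n : ℕ) → R φ ψ n ≡ true)
membership =
  (λ φ ψ → Entailment.entails≤? φ ψ) , λ φ ψ → mk⇔ (Entailment.valid⇒entails≤ φ ψ) (Entailment.entails≤⇒valid φ ψ)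

-- Two-counter machines

execute : Instr → Config → Config
execute i (cfg _ a b) = step (i ∷ []) (cfg 0 a b)

-- junk outside the program
instruction : Program → ℕ → Instr
instruction []       _       = inc fzero 0
instruction (i ∷ _)  zero    = i
instruction (_ ∷ is) (suc j) = instruction is j

mutual
  step-instruction : ∀ P c → Config.pc c < length P → step P c ≡ execute (instruction P (Config.pc c)) c
  step-instruction (i ∷ is) (cfg zero    a b) _ = refl
  step-instruction (i ∷ is) (cfg (suc p) a b) (s≤s p<len) rewrite Equivalence.to T-≡ (<⇒<ᵇ p<len)
    with i ∷ is | suc p | <⇒<ᵇ p<len
  ... | P | q | p<ᵇlen = helper-finds P q a b is p p<ᵇlen

  -- `step` finds the instruction with a helper local to Defs, which cannot be named here; the goal
  -- `helper P q a b Z W ≡ execute (instruction Z W) (cfg _ a b)` is therefore left to unification with the use above.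
  helper-finds : (P : Program) (q a b : ℕ) (Z : Program) (W : ℕ) → T (W <ᵇ length Z) → _
  helper-finds P q a b (i ∷ Z) zero    _     = refl
  helper-finds P q a b (i ∷ Z) (suc W) W<len = helper-finds P q a b Z W W<len

counter : Fin 2 → Config → ℕ
counter fzero    = Config.c₀
counter (fsuc _) = Config.c₁

other : Fin 2 → Fin 2
other fzero    = fsuc fzero
other (fsuc _) = fzero

record Effect (r : Fin 2) (c e : Config) (p v : ℕ) : Set where
  constructor effect
  field
    jumps : Config.pc e ≡ p
    sets  : counter r e ≡ v
    keeps : counter (other r) e ≡ counter (other r) c
open Effect public

execute-inc : ∀ r j c → Effect r c (execute (inc r j) c) j (suc (counter r c))
execute-inc fzero        j (cfg _ a b) = effect refl refl refl
execute-inc (fsuc fzero) j (cfg _ a b) = effect refl refl refl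

execute-dec-zero : ∀ r j k c → counter r c ≡ 0 → Effect r c (execute (dec r j k) c) k 0
execute-dec-zero fzero        j k (cfg _ zero b) refl = effect refl refl refl
execute-dec-zero (fsuc fzero) j k (cfg _ a zero) refl = effect refl refl refl

execute-dec-suc : ∀ r j k c {v} → counter r c ≡ suc v → Effect r c (execute (dec r j k) c) j v
execute-dec-suc fzero        j k (cfg _ (suc a) b) refl = effect refl refl refl
execute-dec-suc (fsuc fzero) j k (cfg _ a (suc b)) refl = effect refl refl refl

execute-dec-keeps : ∀ r j k c → counter (other r) (execute (dec r j k) c) ≡ counter (other r) c
execute-dec-keeps r j k c with counter r c in value
... | zero  = keeps (execute-dec-zero r j k c value)
... | suc _ = keeps (execute-dec-suc r j k c value)

Effect-≡ : ∀ {r c e e′ p v} → e′ ≡ e → Effect r c e p v → Effect r c e′ p v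
Effect-≡ refl eff = eff

-- The reduction

succ-sym next-sym zero-sym false-sym : Sym
succ-sym  = symbol 0 2
next-sym  = symbol 3 2
zero-sym  = symbol 4 1
false-sym = symbol 5 0

head-sym : Fin 2 → Sym
head-sym r = symbol (head-name r) 2
  where
  head-name : Fin 2 → ℕ
  head-name fzero    = 1
  head-name (fsuc _) = 2

label-sym : ℕ → Sym
label-sym m = symbol (6 + m) 1

Succ Next : Var → Var → Formula
Succ x y = rel succ-sym (x ∷ y ∷ [])
Next x y = rel next-sym (x ∷ y ∷ [])

Head : Fin 2 → Var → Var → Formula
Head r x y = rel (head-sym r) (x ∷ y ∷ [])

Zero : Var → Formula
Zero x = rel zero-sym (x ∷ [])

Label : ℕ → Var → Formula
Label m x = rel (label-sym m) (x ∷ [])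

⋁ : List Formula → Formula
⋁ []       = rel false-sym []
⋁ (f ∷ fs) = f ∨' ⋁ fs

LabelUpTo : ℕ → Var → Formula
LabelUpTo zero    x = Label 0 x
LabelUpTo (suc m) x = Label (suc m) x ∨' LabelUpTo m x

Counts : Var → Formula
Counts h = ex 5 (tc 0 (Next 6 7) (6 ∷ []) (7 ∷ []) (h ∷ []) (5 ∷ []) (((λ ()) ∷ []) ∷ [] ∷ []) ∧' Zero 5)

-- following Next from x and from y in lockstep, one side reaches Zero while the other can still step
Differ : Var → Var → Formula
Differ x y =
  ex 7 (ex 8 (tc 1 (Next 10 12 ∧' Next 11 13) (10 ∷ 11 ∷ []) (12 ∷ 13 ∷ []) (x ∷ y ∷ []) (7 ∷ 8 ∷ []) distinct ∧'
              ((Zero 7 ∧' ex 9 (Next 8 9)) ∨' (ex 9 (Next 7 9) ∧' Zero 8))))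
  where
  distinct : Unique (toList ((10 ∷ 11 ∷ []) ++ (12 ∷ 13 ∷ [])))
  distinct = ((λ ()) ∷ (λ ()) ∷ (λ ()) ∷ []) ∷ ((λ ()) ∷ (λ ()) ∷ []) ∷ ((λ ()) ∷ []) ∷ [] ∷ []

Lockstep : (𝔄 : Structure) → Assignment 𝔄 → Vec (Carrier 𝔄) 2 → Vec (Carrier 𝔄) 2 → Set
Lockstep 𝔄 J = Star (TCStep 𝔄 J (10 ∷ 11 ∷ 12 ∷ 13 ∷ []) (Next 10 12 ∧' Next 11 13))

below-7 : ∀ {A : Set} {x} (J : Var → A) a b → x < 7 → update (update J 7 a) 8 b x ≡ J x
below-7 J a b x<7 = trans (update-≢ (update J 7 a) 8 b (<⇒≢ (m<n⇒m<1+n x<7))) (update-≢ J 7 a (<⇒≢ x<7))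

NotSucc : Var → Var → Formula
NotSucc o o′ = Zero o′ ∨' ex 6 (Next o′ 6 ∧' Differ o 6)

-- The variables 0 and 1 hold consecutive time points t, t′; 2 and 3 the heads of the two counters at t, 4 and 5 at t′.
here-head next-head : Fin 2 → Var
here-head fzero    = 2
here-head (fsuc _) = 3
next-head fzero    = 4
next-head (fsuc _) = 5

here-head<6 : ∀ r → here-head r < 6
here-head<6 fzero        = <ᵇ⇒< 2 6 _
here-head<6 (fsuc fzero) = <ᵇ⇒< 3 6 _

next-head<6 : ∀ r → next-head r < 6
next-head<6 fzero        = <ᵇ⇒< 4 6 _
next-head<6 (fsuc fzero) = <ᵇ⇒< 5 6 _

witnesses : ∀ {C : Set} → (Var → C) → (t t′ : C) → (h h′ : Fin 2 → C) → Var → C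
witnesses I t t′ h h′ =
  update (update (update (update (update (update I 0 t) 1 t′) 2 (h fzero)) 3 (h (fsuc fzero))) 4 (h′ fzero)) 5 (h′ (fsuc fzero))

module _ {C : Set} (I : Var → C) (t t′ : C) (h h′ : Fin 2 → C) where

  witnesses-here : ∀ r → witnesses I t t′ h h′ (here-head r) ≡ h r
  witnesses-here fzero        = refl
  witnesses-here (fsuc fzero) = refl

  witnesses-next : ∀ r → witnesses I t t′ h h′ (next-head r) ≡ h′ r
  witnesses-next fzero        = refl
  witnesses-next (fsuc fzero) = refl

⋁-map-dyadic : ∀ {A : Set} (f : A → Formula) → (∀ a → AtMostDyadic (f a)) → ∀ as → AtMostDyadic (⋁ (List.map f as))
⋁-map-dyadic f f-dyadic []       = tt
⋁-map-dyadic f f-dyadic (a ∷ as) = f-dyadic a , ⋁-map-dyadic f f-dyadic as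

LabelUpTo-dyadic : ∀ m x → AtMostDyadic (LabelUpTo m x)
LabelUpTo-dyadic zero    x = tt
LabelUpTo-dyadic (suc m) x = tt , LabelUpTo-dyadic m x

Counts-dyadic : ∀ h → AtMostDyadic (Counts h)
Counts-dyadic h = (s≤s z≤n , tt) , tt

Differ-dyadic : ∀ x y → AtMostDyadic (Differ x y)
Differ-dyadic x y = (s≤s (s≤s z≤n) , tt , tt) , (tt , tt) , (tt , tt)

module Reduction (P : Program) where

  L : ℕ
  L = length P

  -- the label of a configuration is its program counter, with L standing for every halted one
  label : ℕ → ℕ
  label p = p ⊓ L

  label-running : ∀ {p} → p < L → label p ≡ p
  label-running p<L = m≤n⇒m⊓n≡m (<⇒≤ p<L)

  label-halted : ∀ {p} → L ≤ p → label p ≡ L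
  label-halted = m≥n⇒m⊓n≡n

  LabelOtherThan : ℕ → Formula
  LabelOtherThan m₀ = ⋁ (List.map (λ m → Label m 1) (filter (λ m → ¬? (m ≟ m₀)) (upTo (suc L))))

  Error : Instr → Formula
  Error (inc r j)   = LabelOtherThan (label j) ∨' NotSucc (here-head r) (next-head r) ∨' Differ (here-head (other r)) (next-head (other r))
  Error (dec r j k) = (Zero (here-head r) ∧' (LabelOtherThan (label k) ∨' Differ (here-head r) (next-head r)))
                   ∨' (ex 6 (Next (here-head r) 6 ∧' (LabelOtherThan (label j) ∨' Differ 6 (next-head r))))
                   ∨' Differ (here-head (other r)) (next-head (other r))

  FaultyStep : Formula
  FaultyStep = ex 0 (ex 1 (ex 2 (ex 3 (ex 4 (ex 5
    (Succ 0 1 ∧' Head fzero 0 2 ∧' Head (fsuc fzero) 0 3 ∧' Head fzero 1 4 ∧' Head (fsuc fzero) 1 5 ∧'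
     ⋁ (List.map (λ j → Label j 0 ∧' Error (instruction P j)) (upTo L))))))))

  Clash : Formula
  Clash = ex 0 (Label L 0 ∧' ⋁ (List.map (λ m → Label m 0) (upTo L)))

  ψ : Formula
  ψ = FaultyStep ∨' Clash

  Start : Formula
  Start = Label (label 0) 0 ∧' ex 4 (Head fzero 0 4 ∧' Zero 4) ∧' ex 4 (Head (fsuc fzero) 0 4 ∧' Zero 4)

  Tick : Formula
  Tick = Succ 2 3 ∧' LabelUpTo L 3 ∧' ex 4 (Head fzero 3 4 ∧' Counts 4) ∧' ex 4 (Head (fsuc fzero) 3 4 ∧' Counts 4)

  φ : Formula
  φ = ex 0 (ex 1 (Start ∧' tc 0 Tick (2 ∷ []) (3 ∷ []) (0 ∷ []) (1 ∷ []) (((λ ()) ∷ []) ∷ [] ∷ []) ∧' Label L 1))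

  LabelOtherThan-dyadic : ∀ m₀ → AtMostDyadic (LabelOtherThan m₀)
  LabelOtherThan-dyadic m₀ = ⋁-map-dyadic (λ m → Label m 1) (λ _ → tt) (filter (λ m → ¬? (m ≟ m₀)) (upTo (suc L)))

  Error-dyadic : ∀ i → AtMostDyadic (Error i)
  Error-dyadic (inc r j) =
    LabelOtherThan-dyadic (label j) , (tt , tt , Differ-dyadic (here-head r) 6) , Differ-dyadic (here-head (other r)) (next-head (other r))
  Error-dyadic (dec r j k) =
    (tt , LabelOtherThan-dyadic (label k) , Differ-dyadic (here-head r) (next-head r)) ,
    (tt , LabelOtherThan-dyadic (label j) , Differ-dyadic 6 (next-head r)) ,
    Differ-dyadic (here-head (other r)) (next-head (other r))

  ψ-dyadic : AtMostDyadic ψ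
  ψ-dyadic = (tt , tt , tt , tt , tt , ⋁-map-dyadic _ (λ j → tt , Error-dyadic (instruction P j)) (upTo L))
           , (tt , ⋁-map-dyadic _ (λ _ → tt) (upTo L))

  φ-dyadic : AtMostDyadic φ
  φ-dyadic = (tt , (tt , tt) , (tt , tt))
           , (s≤s z≤n , tt , LabelUpTo-dyadic L 3 , (tt , Counts-dyadic 4) , (tt , Counts-dyadic 4)) , tt

-- Non-halting machines give valid implications

module InStructure (𝔄 : Structure) where

  C : Set
  C = Carrier 𝔄

  Succᴿ Nextᴿ : C → C → Set
  Succᴿ x y = interp 𝔄 succ-sym (x ∷ y ∷ [])
  Nextᴿ x y = interp 𝔄 next-sym (x ∷ y ∷ [])

  Headᴿ : Fin 2 → C → C → Set
  Headᴿ r x y = interp 𝔄 (head-sym r) (x ∷ y ∷ [])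

  Zeroᴿ : C → Set
  Zeroᴿ x = interp 𝔄 zero-sym (x ∷ [])

  Labelᴿ : ℕ → C → Set
  Labelᴿ m x = interp 𝔄 (label-sym m) (x ∷ [])

  data Path : ℕ → C → C → Set where
    []  : ∀ {x} → Path 0 x x
    _∷_ : ∀ {n x y z} → Nextᴿ x y → Path n y z → Path (suc n) x z

  record Counter (h : C) (v : ℕ) : Set where
    constructor counter-chain
    field
      {last} : C
      path   : Path v h last
      ends   : Zeroᴿ last

  record CounterAt (r : Fin 2) (t : C) (v : ℕ) : Set where
    constructor counter-at
    field
      {head} : C
      heads  : Headᴿ r t head
      counts : Counter head v
  open CounterAt public

  Counts-sound : ∀ {J} x → x ≢ 5 → Sat 𝔄 J (Counts x) → Σ ℕ (Counter (J x))
  Counts-sound {J} x x≢5 (z , star , z-zero) =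
    let n , p = toPath star in n , counter-chain (subst (λ h → Path n h z) (update-≢ J 5 z x≢5) p) z-zero
    where
    toPath : ∀ {a b} → Star (TCStep 𝔄 (update J 5 z) (6 ∷ 7 ∷ []) (Next 6 7)) (a ∷ []) (b ∷ []) → Σ ℕ λ n → Path n a b
    toPath ε = 0 , []
    toPath (_◅_ {j = _ ∷ []} next rest) = let n , p = toPath rest in suc n , next ∷ p

  record Diverge (a a′ : C) : Set where
    constructor diverge
    field
      {end end′} : C
      -- for every ambient assignment, since Differ chooses it from the endpoints
      lockstep   : ∀ J → Lockstep 𝔄 J (a ∷ a′ ∷ []) (end ∷ end′ ∷ [])
      split      : (Zeroᴿ end × Σ C (Nextᴿ end′)) ⊎ (Σ C (Nextᴿ end) × Zeroᴿ end′)

  diverge-lengths : ∀ {m m′ a a′ b b′} → Path m a b → Zeroᴿ b → Path m′ a′ b′ → Zeroᴿ b′ → m ≢ m′ → Diverge a a′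
  diverge-lengths []         _ []           _  m≢m′ = contradiction refl m≢m′
  diverge-lengths []         z (next ∷ _)   _  _    = diverge (λ _ → ε) (inj₁ (z , _ , next))
  diverge-lengths (next ∷ _) _ []           z′ _    = diverge (λ _ → ε) (inj₂ ((_ , next) , z′))
  diverge-lengths (next ∷ p) z (next′ ∷ p′) z′ m≢m′ =
    let diverge steps split = diverge-lengths p z p′ z′ (λ m≡m′ → m≢m′ (cong suc m≡m′)) in
    diverge (λ J → (next , next′) ◅ steps J) split

  Differ-intro : ∀ J {x y m m′} → x < 7 → y < 7 → Counter (J x) m → Counter (J y) m′ → m ≢ m′ → Sat 𝔄 J (Differ x y)
  Differ-intro J {x} {y} x<7 y<7 (counter-chain p z) (counter-chain p′ z′) m≢m′ =
    let diverge {e} {e′} steps split = diverge-lengths p z p′ z′ m≢m′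
        J′ = update (update J 7 e) 8 e′
    in e , e′ ,
       subst₂ (λ a a′ → Lockstep 𝔄 J′ (a ∷ a′ ∷ []) (e ∷ e′ ∷ [])) (sym (below-7 J e e′ x<7)) (sym (below-7 J e e′ y<7)) (steps J′) ,
       split

  NotSucc-intro : ∀ J {o o′ v v′} → o < 6 → o′ < 6 → Counter (J o) v → Counter (J o′) v′ → v′ ≢ suc v →
                  Sat 𝔄 J (NotSucc o o′)
  NotSucc-intro J o<6 o′<6 _ (counter-chain [] z′) _ = inj₁ z′
  NotSucc-intro J {o} {o′} o<6 o′<6 (counter-chain p z) (counter-chain (_∷_ {y = u} next p′) z′) v′≢1+v =
    inj₂ (u , subst (λ a → Nextᴿ a u) (sym (at o′<6)) next ,
          Differ-intro J′ (m<n⇒m<1+n o<6) ≤-refl (counter-chain (subst (λ a → Path _ a _) (sym (at o<6)) p) z) (counter-chain p′ z′)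
                       (λ v≡w → v′≢1+v (cong suc (sym v≡w))))
    where
    J′ = update J 6 u
    at : ∀ {x} → x < 6 → J′ x ≡ J x
    at x<6 = update-≢ J 6 u (<⇒≢ x<6)

  ⋁-intro : ∀ J {f fs} → f ∈ fs → Sat 𝔄 J f → Sat 𝔄 J (⋁ fs)
  ⋁-intro J (here refl) ⊨f = inj₁ ⊨f
  ⋁-intro J (there f∈fs) ⊨f = inj₂ (⋁-intro J f∈fs ⊨f)

  LabelUpTo-sound : ∀ J m x → Sat 𝔄 J (LabelUpTo m x) → Σ ℕ λ k → k ≤ m × Labelᴿ k (J x)
  LabelUpTo-sound J zero    x labelled        = 0 , z≤n , labelled
  LabelUpTo-sound J (suc m) x (inj₁ labelled) = suc m , ≤-refl , labelled
  LabelUpTo-sound J (suc m) x (inj₂ below)    = let k , k≤m , labelled = LabelUpTo-sound J m x below in k , m≤n⇒m≤1+n k≤m , labelled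

fin2-cases : ∀ r r′ → r′ ≡ r ⊎ r′ ≡ other r
fin2-cases fzero        fzero        = inj₁ refl
fin2-cases fzero        (fsuc fzero) = inj₂ refl
fin2-cases (fsuc fzero) fzero        = inj₂ refl
fin2-cases (fsuc fzero) (fsuc fzero) = inj₁ refl

module Simulation (P : Program) (𝔄 : Structure) where
  open Reduction P
  open InStructure 𝔄

  LabelOtherThan-intro : ∀ J {m m₀} → m ≤ L → m ≢ m₀ → Labelᴿ m (J 1) → Sat 𝔄 J (LabelOtherThan m₀)
  LabelOtherThan-intro J {m} {m₀} m≤L m≢m₀ =
    ⋁-intro J (∈-map⁺ (λ k → Label k 1) (∈-filter⁺ (λ k → ¬? (k ≟ m₀)) (∈-upTo⁺ (s≤s m≤L)) m≢m₀))

  record Represents (t : C) (c : Config) : Set where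
    field
      labelled : Labelᴿ (label (Config.pc c)) t
      counters : ∀ r → CounterAt r t (counter r c)

  record Successor (t t′ : C) : Set where
    field
      succ     : Succᴿ t t′
      lab      : ℕ
      lab≤L    : lab ≤ L
      labelled : Labelᴿ lab t′
      value    : Fin 2 → ℕ
      counters : ∀ r → CounterAt r t′ (value r)

  -- J is the assignment at which FaultyStep examines the step from t to t′
  module Advance {I : Assignment 𝔄} {t t′ c} (rep : Represents t c) (after : Successor t t′) where
    open Successor after using (lab; lab≤L; value)

    here-heads next-heads : Fin 2 → C
    here-heads r = head (Represents.counters rep r)
    next-heads r = head (Successor.counters after r)

    J : Assignment 𝔄
    J = witnesses I t t′ here-heads next-heads

    here-counter : ∀ r → Counter (J (here-head r)) (counter r c)
    here-counter r = subst (λ h → Counter h _) (sym (witnesses-here I t t′ here-heads next-heads r)) (counts (Represents.counters rep r))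

    next-counter : ∀ r → Counter (J (next-head r)) (value r)
    next-counter r = subst (λ h → Counter h _) (sym (witnesses-next I t t′ here-heads next-heads r)) (counts (Successor.counters after r))

    label-or-error : ∀ J′ m₀ → Labelᴿ lab (J′ 1) → lab ≡ m₀ ⊎ Sat 𝔄 J′ (LabelOtherThan m₀)
    label-or-error J′ m₀ labelled with lab ≟ m₀
    ... | yes lab≡m₀ = inj₁ lab≡m₀
    ... | no  lab≢m₀ = inj₂ (LabelOtherThan-intro J′ lab≤L lab≢m₀ labelled)

    other-or-error : ∀ r → value (other r) ≡ counter (other r) c ⊎ Sat 𝔄 J (Differ (here-head (other r)) (next-head (other r)))
    other-or-error r with value (other r) ≟ counter (other r) c
    ... | yes same = inj₁ same
    ... | no  diff = inj₂ (Differ-intro J (m<n⇒m<1+n (here-head<6 (other r))) (m<n⇒m<1+n (next-head<6 (other r)))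
                                      (here-counter (other r)) (next-counter (other r)) (λ same → diff (sym same)))

    represents : ∀ {r e p v} → Effect r c e p v → lab ≡ label p → value r ≡ v → value (other r) ≡ counter (other r) c →
                 Represents t′ e
    represents {r} {e} eff lab≡ own≡ other≡ = record
      { labelled = subst (λ m → Labelᴿ m t′) (trans lab≡ (cong label (sym (jumps eff)))) (Successor.labelled after)
      ; counters = λ r′ → subst (CounterAt r′ t′) (value≡ r′) (Successor.counters after r′)
      }
      where
      value≡ : ∀ r′ → value r′ ≡ counter r′ e
      value≡ r′ with fin2-cases r r′
      ... | inj₁ refl = trans own≡ (sym (sets eff))
      ... | inj₂ refl = trans other≡ (sym (keeps eff))

    inc-or-error : ∀ r j → Represents t′ (execute (inc r j) c) ⊎ Sat 𝔄 J (Error (inc r j))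
    inc-or-error r j
      with label-or-error J (label j) (Successor.labelled after) | value r ≟ suc (counter r c) | other-or-error r
    ... | inj₂ wrong-label | _        | _                  = inj₂ (inj₁ wrong-label)
    ... | inj₁ _           | no wrong | _                  =
      inj₂ (inj₂ (inj₁ (NotSucc-intro J (here-head<6 r) (next-head<6 r) (here-counter r) (next-counter r) wrong)))
    ... | inj₁ _           | yes _    | inj₂ other-changed = inj₂ (inj₂ (inj₂ other-changed))
    ... | inj₁ lab≡        | yes own≡ | inj₁ other≡       = inj₁ (represents (execute-inc r j c) lab≡ own≡ other≡)

    J+ : C → Assignment 𝔄
    J+ u = update J 6 u

    J+-counter : ∀ {u x v} → x < 6 → Counter (J x) v → Counter (J+ u x) v
    J+-counter {u} x<6 = subst (λ h → Counter h _) (sym (update-≢ J 6 u (<⇒≢ x<6)))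

    J+-step : ∀ r {u} → Nextᴿ (J (here-head r)) u → Nextᴿ (J+ u (here-head r)) u
    J+-step r {u} = subst (λ a → Nextᴿ a u) (sym (update-≢ J 6 u (<⇒≢ (here-head<6 r))))

    dec-or-error : ∀ r j k {v} → Counter (J (here-head r)) v → counter r c ≡ v →
                   Represents t′ (execute (dec r j k) c) ⊎ Sat 𝔄 J (Error (dec r j k))
    dec-or-error r j k (counter-chain [] z) c≡0
      with label-or-error J (label k) (Successor.labelled after) | value r ≟ 0 | other-or-error r
    ... | inj₂ wrong-label | _        | _                  = inj₂ (inj₁ (z , inj₁ wrong-label))
    ... | inj₁ _           | no wrong | _                  =
      inj₂ (inj₁ (z , inj₂ (Differ-intro J (m<n⇒m<1+n (here-head<6 r)) (m<n⇒m<1+n (next-head<6 r))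
                              (counter-chain [] z) (next-counter r) (λ same → wrong (sym same)))))
    ... | inj₁ _           | yes _    | inj₂ other-changed = inj₂ (inj₂ (inj₂ other-changed))
    ... | inj₁ lab≡        | yes own≡ | inj₁ other≡       = inj₁ (represents (execute-dec-zero r j k c c≡0) lab≡ own≡ other≡)
    dec-or-error r j k {suc w} (counter-chain (_∷_ {y = u} step p) z) c≡1+w
      with label-or-error (J+ u) (label j) (Successor.labelled after) | value r ≟ w | other-or-error r
    ... | inj₂ wrong-label | _        | _                  = inj₂ (inj₂ (inj₁ (u , J+-step r step , inj₁ wrong-label)))
    ... | inj₁ _           | no wrong | _                  =
      inj₂ (inj₂ (inj₁ (u , J+-step r step , inj₂ (Differ-intro (J+ u) (<ᵇ⇒< 6 7 _) (m<n⇒m<1+n (next-head<6 r))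
                                                  (counter-chain p z) (J+-counter (next-head<6 r) (next-counter r))
                                                  (λ same → wrong (sym same))))))
    ... | inj₁ _           | yes _    | inj₂ other-changed = inj₂ (inj₂ (inj₂ other-changed))
    ... | inj₁ lab≡        | yes own≡ | inj₁ other≡       = inj₁ (represents (execute-dec-suc r j k c c≡1+w) lab≡ own≡ other≡)

    advance-or-error : ∀ i → Represents t′ (execute i c) ⊎ Sat 𝔄 J (Error i)
    advance-or-error (inc r j)   = inc-or-error r j
    advance-or-error (dec r j k) = dec-or-error r j k (here-counter r) refl

  decode : ∀ {J t t′} → TCStep 𝔄 J (2 ∷ 3 ∷ []) Tick (t ∷ []) (t′ ∷ []) → Successor t t′
  decode (succ , labels , (_ , headsA , countsA) , (_ , headsB , countsB)) =
    let lab , lab≤L , labelled = LabelUpTo-sound _ L 3 labels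
        vA , chainA = Counts-sound 4 (λ ()) countsA
        vB , chainB = Counts-sound 4 (λ ()) countsB
    in record
      { succ = succ ; lab = lab ; lab≤L = lab≤L ; labelled = labelled
      ; value    = λ { fzero → vA ; (fsuc _) → vB }
      ; counters = λ { fzero → counter-at headsA chainA ; (fsuc fzero) → counter-at headsB chainB }
      }

  running-label : ∀ {t c} → Represents t c → Config.pc c < L → Labelᴿ (Config.pc c) t
  running-label rep pc<L = subst (λ m → Labelᴿ m _) (label-running pc<L) (Represents.labelled rep)

  module _ (¬halts : ¬ Halts P) (I : Assignment 𝔄) {J₁ : Assignment 𝔄} {tₙ : C} (halted : Labelᴿ L tₙ) where

    mutual
      simulate : ∀ i {t} → Represents t (run P i) → Star (TCStep 𝔄 J₁ (2 ∷ 3 ∷ []) Tick) (t ∷ []) (tₙ ∷ []) → Sat 𝔄 I ψ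
      simulate i rep path with Config.pc (run P i) <? L
      ... | no  pc≮L = contradiction (i , ≮⇒≥ pc≮L) ¬halts
      ... | yes pc<L = simulate-running i rep pc<L path

      simulate-running : ∀ i {t} → Represents t (run P i) → Config.pc (run P i) < L →
                         Star (TCStep 𝔄 J₁ (2 ∷ 3 ∷ []) Tick) (t ∷ []) (tₙ ∷ []) → Sat 𝔄 I ψ
      simulate-running i rep pc<L ε =
        inj₂ (tₙ , halted , ⋁-intro _ (∈-map⁺ (λ m → Label m 0) (∈-upTo⁺ pc<L)) (running-label rep pc<L))
      simulate-running i {t} rep pc<L (_◅_ {j = t′ ∷ []} tick rest)
        with Advance.advance-or-error {I = I} rep (decode tick) (instruction P (Config.pc (run P i)))
      ... | inj₁ rep′ = simulate (suc i) (subst (Represents t′) (sym (step-instruction P (run P i) pc<L)) rep′) rest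
      ... | inj₂ err  = inj₁ (t , t′ , _ , _ , _ , _ , Successor.succ after ,
                              heads (counters fzero) , heads (counters (fsuc fzero)) ,
                              heads (Successor.counters after fzero) , heads (Successor.counters after (fsuc fzero)) ,
                              ⋁-intro _ (∈-map⁺ (λ j → Label j 0 ∧' Error (instruction P j)) (∈-upTo⁺ pc<L))
                                        (running-label rep pc<L , err))
        where
        after = decode tick
        open Represents rep using (counters)

non-halting⇒valid : ∀ P → ¬ Halts P → ValidImp (Reduction.φ P) (Reduction.ψ P)
non-halting⇒valid P ¬halts 𝔄 I (t₀ , tₙ , (start-label , (_ , headsA , zeroA) , (_ , headsB , zeroB)) , path , halted) =
  simulate ¬halts I halted 0 represents-initial path
  where
  open Simulation P 𝔄
  open InStructure 𝔄
  represents-initial : Represents t₀ (run P 0)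
  represents-initial = record
    { labelled = start-label
    ; counters = λ { fzero → counter-at headsA (counter-chain [] zeroA) ; (fsuc fzero) → counter-at headsB (counter-chain [] zeroB) }
    }

-- A halting run refutes the implication

next-pair : ℕ × ℕ → ℕ × ℕ
next-pair (a , zero)  = 0 , suc a
next-pair (a , suc b) = suc a , b

-- Cantor's enumeration, walking the antidiagonals
unpair : ℕ → ℕ × ℕ
unpair zero    = 0 , 0
unpair (suc n) = next-pair (unpair n)

unpair-surjective : ∀ a b → Σ ℕ λ n → unpair n ≡ (a , b)
unpair-surjective a b = on-diagonal (a + b) a b refl
  where
  on-diagonal : ∀ s a b → a + b ≡ s → Σ ℕ λ n → unpair n ≡ (a , b)
  on-diagonal s       zero    zero    _   = 0 , refl
  on-diagonal s       (suc a) b       a+b =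
    let n , ≡ab = on-diagonal s a (suc b) (trans (+-suc a b) a+b) in suc n , cong next-pair ≡ab
  on-diagonal (suc s) zero    (suc b) a+b =
    let n , ≡ab = on-diagonal s b 0 (trans (+-identityʳ b) (suc-injective a+b)) in suc n , cong next-pair ≡ab

-- time i, and the cell at distance d from the end of the chain of counter r at time i
data Element : Set where
  time : ℕ → Element
  cell : Fin 2 → ℕ → ℕ → Element

fromPair : ℕ × ℕ → Element
fromPair (zero        , m) = time m
fromPair (suc zero    , m) = cell fzero        (proj₁ (unpair m)) (proj₂ (unpair m))
fromPair (suc (suc _) , m) = cell (fsuc fzero) (proj₁ (unpair m)) (proj₂ (unpair m))

enumerate : ℕ → Element
enumerate n = fromPair (unpair n)

enumerate-surjective : ∀ e → Σ ℕ λ n → enumerate n ≡ e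
enumerate-surjective (time m) = let n , ≡0m = unpair-surjective 0 m in n , cong fromPair ≡0m
enumerate-surjective (cell r i d) =
  let m , ≡id = unpair-surjective i d
      n , ≡km = unpair-surjective (code r) m
  in n , trans (cong fromPair ≡km) (from-code r ≡id)
  where
  code : Fin 2 → ℕ
  code fzero    = 1
  code (fsuc _) = 2
  from-code : ∀ r {m} → unpair m ≡ (i , d) → fromPair (code r , m) ≡ cell r i d
  from-code fzero        refl = refl
  from-code (fsuc fzero) refl = refl

module Countermodel (P : Program) (N : ℕ) where
  open Reduction P

  value : Fin 2 → ℕ → ℕ
  value r i = counter r (run P i)

  Succᴹ Nextᴹ : Element → Element → Set
  Succᴹ (time i) (time i′) = i′ ≡ suc i × i < N
  Succᴹ _        _         = ⊥
  Nextᴹ (cell r i d) (cell r′ i′ d′) = r′ ≡ r × i′ ≡ i × d ≡ suc d′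
  Nextᴹ _            _               = ⊥

  Headᴹ : Fin 2 → Element → Element → Set
  Headᴹ r (time i) (cell r′ i′ d) = r′ ≡ r × i′ ≡ i × d ≡ value r i
  Headᴹ r _        _              = ⊥

  Zeroᴹ : Element → Set
  Zeroᴹ (cell _ _ d) = d ≡ 0
  Zeroᴹ (time _)     = ⊥

  Labelᴹ : ℕ → Element → Set
  Labelᴹ m (time i) = m ≡ label (Config.pc (run P i))
  Labelᴹ m _        = ⊥

  -- the literal patterns are succ-sym, head-sym, next-sym, zero-sym and label-sym
  interpretation : (R : Sym) → Vec Element (arity R) → Set
  interpretation (symbol 0 2) (x ∷ y ∷ []) = Succᴹ x y
  interpretation (symbol 1 2) (x ∷ y ∷ []) = Headᴹ fzero x y
  interpretation (symbol 2 2) (x ∷ y ∷ []) = Headᴹ (fsuc fzero) x y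
  interpretation (symbol 3 2) (x ∷ y ∷ []) = Nextᴹ x y
  interpretation (symbol 4 1) (x ∷ [])     = Zeroᴹ x
  interpretation (symbol (suc (suc (suc (suc (suc (suc m)))))) 1) (x ∷ []) = Labelᴹ m x
  interpretation _            _            = ⊥

  𝔐 : Structure
  𝔐 = record
    { Carrier   = Element
    ; enum      = enumerate
    ; enum-surj = λ e → let n , ≡e = enumerate-surjective e in n , λ { refl → ≡e }
    ; interp    = interpretation
    }

  distance : Element → ℕ
  distance (time _)     = 0
  distance (cell _ _ d) = d

  Next-distance : ∀ {u v} → Nextᴹ u v → distance u ≡ suc (distance v)
  Next-distance {cell _ _ _} {cell _ _ _} (_ , _ , d≡1+d′) = d≡1+d′

  Zero-distance : ∀ {u} → Zeroᴹ u → distance u ≡ 0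
  Zero-distance {cell _ _ _} d≡0 = d≡0

  lockstep-distance : ∀ {J a a′ b b′} → Lockstep 𝔐 J (a ∷ a′ ∷ []) (b ∷ b′ ∷ []) → distance a ≡ distance a′ → distance b ≡ distance b′
  lockstep-distance ε same = same
  lockstep-distance (_◅_ {j = _ ∷ _ ∷ []} (next , next′) rest) same =
    lockstep-distance rest (suc-injective (trans (sym (Next-distance next)) (trans same (Next-distance next′))))

  Differ-sound : ∀ J {x y} → x < 7 → y < 7 → Sat 𝔐 J (Differ x y) → distance (J x) ≢ distance (J y)
  Differ-sound J {x} {y} x<7 y<7 (e , e′ , steps , split) same
    with lockstep-distance steps (trans (cong distance (below-7 J e e′ x<7)) (trans same (cong distance (sym (below-7 J e e′ y<7)))))
  ... | e≡e′ with split
  ... | inj₁ (end-zero , _ , next′) = contradiction (trans (sym (Zero-distance end-zero)) (trans e≡e′ (Next-distance next′))) λ ()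
  ... | inj₂ ((_ , next) , end-zero′) = contradiction (trans (sym (Next-distance next)) (trans e≡e′ (Zero-distance end-zero′))) λ ()

  NotSucc-sound : ∀ J {o o′} → o < 6 → o′ < 6 → Sat 𝔐 J (NotSucc o o′) → distance (J o′) ≢ suc (distance (J o))
  NotSucc-sound J o<6 o′<6 (inj₁ z) o′≡1+o = contradiction (trans (sym (Zero-distance z)) o′≡1+o) λ ()
  NotSucc-sound J {o} {o′} o<6 o′<6 (inj₂ (u , next , differ)) o′≡1+o =
    Differ-sound J′ (m<n⇒m<1+n o<6) (<ᵇ⇒< 6 7 _) differ
      (trans (cong distance (at o<6)) (suc-injective (trans (sym o′≡1+o) (trans (cong distance (sym (at o′<6))) (Next-distance next)))))
    where
    J′ = update J 6 u
    at : ∀ {x} → x < 6 → J′ x ≡ J x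
    at x<6 = update-≢ J 6 u (<⇒≢ x<6)

  ⋁-sound : ∀ J fs → Sat 𝔐 J (⋁ fs) → Σ Formula λ f → f ∈ fs × Sat 𝔐 J f
  ⋁-sound J (f ∷ fs) (inj₁ ⊨f)  = f , here refl , ⊨f
  ⋁-sound J (f ∷ fs) (inj₂ ⊨fs) = let g , g∈fs , ⊨g = ⋁-sound J fs ⊨fs in g , there g∈fs , ⊨g

  LabelOtherThan-sound : ∀ J m₀ → Sat 𝔐 J (LabelOtherThan m₀) → Σ ℕ λ m → m ≢ m₀ × Labelᴹ m (J 1)
  LabelOtherThan-sound J m₀ ⊨labels
    with _ , f∈ , labelled ← ⋁-sound J (List.map (λ m → Label m 1) (filter (λ m → ¬? (m ≟ m₀)) (upTo (suc L)))) ⊨labels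
    with ∈-map⁻ (λ m → Label m 1) f∈
  ... | m , m∈ , refl = m , proj₂ (∈-filter⁻ (λ k → ¬? (k ≟ m₀)) {xs = upTo (suc L)} m∈) , labelled

  record Snapshot (J : Assignment 𝔐) (i : ℕ) : Set where
    field
      later-label : ∀ {m} → Labelᴹ m (J 1) → m ≡ label (Config.pc (run P (suc i)))
      here-distance    : ∀ r → distance (J (here-head r)) ≡ value r i
      next-distance    : ∀ r → distance (J (next-head r)) ≡ value r (suc i)

  module NoError {J : Assignment 𝔐} {i : ℕ} (snapshot : Snapshot J i) where
    open Snapshot snapshot

    right-label : ∀ J′ {m₀} → J′ 1 ≡ J 1 → label (Config.pc (run P (suc i))) ≡ m₀ → ¬ Sat 𝔐 J′ (LabelOtherThan m₀)
    right-label J′ {m₀} J′1≡J1 ≡m₀ wrong =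
      let m , m≢m₀ , labelled = LabelOtherThan-sound J′ m₀ wrong
      in m≢m₀ (trans (later-label (subst (Labelᴹ m) J′1≡J1 labelled)) ≡m₀)

    other-kept : ∀ r → value (other r) (suc i) ≡ value (other r) i → ¬ Sat 𝔐 J (Differ (here-head (other r)) (next-head (other r)))
    other-kept r kept differ =
      Differ-sound J (m<n⇒m<1+n (here-head<6 (other r))) (m<n⇒m<1+n (next-head<6 (other r))) differ
        (trans (here-distance (other r)) (trans (sym kept) (sym (next-distance (other r)))))

    inc-sound : ∀ {r j} → Effect r (run P i) (run P (suc i)) j (suc (value r i)) → ¬ Sat 𝔐 J (Error (inc r j))
    inc-sound     eff (inj₁ wrong-label)  = right-label J refl (cong label (jumps eff)) wrong-label
    inc-sound {r} eff (inj₂ (inj₁ not-succ)) =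
      NotSucc-sound J (here-head<6 r) (next-head<6 r) not-succ (trans (next-distance r) (trans (sets eff) (cong suc (sym (here-distance r)))))
    inc-sound {r} eff (inj₂ (inj₂ differ)) = other-kept r (keeps eff) differ

    dec-zero-sound : ∀ {r k} → Effect r (run P i) (run P (suc i)) k 0 → Zeroᴹ (J (here-head r)) →
                     ¬ Sat 𝔐 J (LabelOtherThan (label k) ∨' Differ (here-head r) (next-head r))
    dec-zero-sound     eff z (inj₁ wrong-label) = right-label J refl (cong label (jumps eff)) wrong-label
    dec-zero-sound {r} eff z (inj₂ differ) =
      Differ-sound J (m<n⇒m<1+n (here-head<6 r)) (m<n⇒m<1+n (next-head<6 r)) differ (trans (Zero-distance z) (sym (trans (next-distance r) (sets eff))))

    dec-suc-sound : ∀ {r j u} → Effect r (run P i) (run P (suc i)) j (distance u) →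
                    ¬ Sat 𝔐 (update J 6 u) (LabelOtherThan (label j) ∨' Differ 6 (next-head r))
    dec-suc-sound {u = u} eff (inj₁ wrong-label) = right-label (update J 6 u) refl (cong label (jumps eff)) wrong-label
    dec-suc-sound {r} {u = u} eff (inj₂ differ) =
      Differ-sound (update J 6 u) (<ᵇ⇒< 6 7 _) (m<n⇒m<1+n (next-head<6 r)) differ
        (sym (trans (cong distance (update-≢ J 6 u (<⇒≢ (next-head<6 r)))) (trans (next-distance r) (sets eff))))

    no-error : ∀ ins → run P (suc i) ≡ execute ins (run P i) → ¬ Sat 𝔐 J (Error ins)
    no-error (inc r j)   ran = inc-sound (Effect-≡ ran (execute-inc r j (run P i)))
    no-error (dec r j k) ran (inj₁ (z , rest)) =
      dec-zero-sound (Effect-≡ ran (execute-dec-zero r j k (run P i) (trans (sym (here-distance r)) (Zero-distance z)))) z rest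
    no-error (dec r j k) ran (inj₂ (inj₁ (u , next , rest))) =
      dec-suc-sound (Effect-≡ ran (execute-dec-suc r j k (run P i) here≡1+u)) rest
      where
      here≡1+u : value r i ≡ suc (distance u)
      here≡1+u = trans (sym (here-distance r)) (trans (cong distance (sym (update-≢ J 6 u (<⇒≢ (here-head<6 r))))) (Next-distance next))
    no-error (dec r j k) ran (inj₂ (inj₂ differ)) =
      other-kept r (trans (cong (counter (other r)) ran) (execute-dec-keeps r j k (run P i))) differ

  Succᴹ-inv : ∀ {t t′} → Succᴹ t t′ → Σ ℕ λ i → t ≡ time i × t′ ≡ time (suc i)
  Succᴹ-inv {time i} {time _} (refl , _) = i , refl , refl

  Headᴹ-inv : ∀ r i {h} → Headᴹ r (time i) h → h ≡ cell r i (value r i)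
  Headᴹ-inv r i {cell _ _ _} (refl , refl , refl) = refl

  running : ∀ {j p} → j < L → j ≡ label p → p < L
  running {j} {p} j<L j≡ with p <? L
  ... | yes p<L = p<L
  ... | no  p≮L = contradiction (trans j≡ (label-halted (≮⇒≥ p≮L))) (<⇒≢ j<L)

  no-clash : ∀ J → ¬ Sat 𝔐 J Clash
  no-clash J (time i , L≡ , running-label)
    with _ , f∈ , ⊨f ← ⋁-sound _ (List.map (λ m → Label m 0) (upTo L)) running-label
    with m , m∈ , refl ← ∈-map⁻ (λ m → Label m 0) f∈
    = <⇒≢ (∈-upTo⁻ m∈) (trans ⊨f (sym L≡))

  no-faulty-step : ∀ J → ¬ Sat 𝔐 J FaultyStep
  no-faulty-step J (_ , _ , _ , _ , _ , _ , succ , ha , hb , ha′ , hb′ , errors)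
    with i , refl , refl ← Succᴹ-inv succ
    with refl ← Headᴹ-inv fzero i ha | refl ← Headᴹ-inv (fsuc fzero) i hb
       | refl ← Headᴹ-inv fzero (suc i) ha′ | refl ← Headᴹ-inv (fsuc fzero) (suc i) hb′
    with _ , f∈ , ⊨f ← ⋁-sound _ (List.map (λ j → Label j 0 ∧' Error (instruction P j)) (upTo L)) errors
    with j , j∈ , refl ← ∈-map⁻ (λ j → Label j 0 ∧' Error (instruction P j)) f∈
    = NoError.no-error snapshot (instruction P j) ran (proj₂ ⊨f)
    where
    labelled = proj₁ ⊨f
    here-cells next-cells : Fin 2 → Element
    here-cells r = cell r i (value r i)
    next-cells r = cell r (suc i) (value r (suc i))
    snapshot : Snapshot (witnesses J (time i) (time (suc i)) here-cells next-cells) i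
    snapshot = record
      { later-label = λ labelled → labelled
      ; here-distance    = λ r → cong distance (witnesses-here J _ _ here-cells next-cells r)
      ; next-distance    = λ r → cong distance (witnesses-next J _ _ here-cells next-cells r)
      }
    pc<L = running (∈-upTo⁻ j∈) labelled
    ran : run P (suc i) ≡ execute (instruction P j) (run P i)
    ran = trans (step-instruction P (run P i) pc<L)
                (cong (λ p → execute (instruction P p) (run P i)) (trans (sym (label-running pc<L)) (sym labelled)))

  LabelUpTo-intro : ∀ J m x {k} → k ≤ m → Labelᴹ k (J x) → Sat 𝔐 J (LabelUpTo m x)
  LabelUpTo-intro J zero    x z≤n     labelled = labelled
  LabelUpTo-intro J (suc m) x k≤1+m labelled with m<1+n⇒m<n∨m≡n (s≤s k≤1+m)
  ... | inj₁ (s≤s k≤m) = inj₂ (LabelUpTo-intro J m x k≤m labelled)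
  ... | inj₂ refl      = inj₁ labelled

  descend : ∀ J r i d → Star (TCStep 𝔐 J (6 ∷ 7 ∷ []) (Next 6 7)) (cell r i d ∷ []) (cell r i 0 ∷ [])
  descend J r i zero    = ε
  descend J r i (suc d) = (refl , refl , refl) ◅ descend J r i d

  counts : ∀ J r i → Sat 𝔐 (update J 4 (cell r i (value r i))) (Counts 4)
  counts J r i = cell r i 0 , descend _ r i (value r i) , refl

  module _ (halted : L ≤ Config.pc (run P N)) where

    tick : ∀ J i → i < N → TCStep 𝔐 J (2 ∷ 3 ∷ []) Tick (time i ∷ []) (time (suc i) ∷ [])
    tick J i i<N =
      (refl , i<N) , LabelUpTo-intro _ L 3 (m⊓n≤n _ L) refl ,
      (cell fzero (suc i) _ , (refl , refl , refl) , counts _ fzero (suc i)) ,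
      (cell (fsuc fzero) (suc i) _ , (refl , refl , refl) , counts _ (fsuc fzero) (suc i))

    ticks : ∀ J n → n ≤ N → Star (TCStep 𝔐 J (2 ∷ 3 ∷ []) Tick) (time 0 ∷ []) (time n ∷ [])
    ticks J zero    _   = ε
    ticks J (suc n) n<N = ticks J n (<⇒≤ n<N) ◅◅ (tick J n n<N ◅ ε)

    φ-holds : ∀ J → Sat 𝔐 J φ
    φ-holds J =
      time 0 , time N ,
      (refl , (cell fzero 0 0 , (refl , refl , refl) , refl) , (cell (fsuc fzero) 0 0 , (refl , refl , refl) , refl)) ,
      ticks _ N ≤-refl , sym (label-halted halted)

halting⇒invalid : ∀ P → Halts P → ¬ ValidImp (Reduction.φ P) (Reduction.ψ P)
halting⇒invalid P (N , halted) valid with valid 𝔐 J (φ-holds halted J)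
  where
  open Countermodel P N
  J : Assignment 𝔐
  J _ = time 0
... | inj₁ faulty = Countermodel.no-faulty-step P N _ faulty
... | inj₂ clash  = Countermodel.no-clash P N _ clash

proposition21 :
    -- membership in Π⁰₁: validity of φ → ψ is ∀n of a computable predicate
    (Σ (Formula → Formula → ℕ → Bool) λ R →
       (φ ψ : Formula) → ValidImp φ ψ ⇔ ((n : ℕ) → R φ ψ n ≡ true))
    ×
    -- Π⁰₁-hardness, even for at most dyadic TC: computable many-one
    -- reduction from non-halting of two-counter machines
    (Σ (Program → Formula × Formula) λ f →
       (P : Program) →
         AtMostDyadic (proj₁ (f P)) × AtMostDyadic (proj₂ (f P)) ×
         (ValidImp (proj₁ (f P)) (proj₂ (f P)) ⇔ (¬ Halts P)))
proposition21 =
  membership ,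
  (λ P → Reduction.φ P , Reduction.ψ P) ,
  λ P → Reduction.φ-dyadic P , Reduction.ψ-dyadic P ,
        mk⇔ (λ valid halts → halting⇒invalid P halts valid) (non-halting⇒valid P)
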